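{- For any sentence $\phi$ of Paraconsistent Non-dependence Logic there exists a universal second-order ($\Pi_1^1$) sentence $\Phi$ such that for all models $M$ over the signature, $M\models_P^+\phi$ if and only if $M\models\Phi$. Conversely, for any universal second-order ($\Pi_1^1$) sentence $\Phi$ there is a Paraconsistent Non-dependence Logic sentence $\phi$ such that for all models $M$ over the signature, $M\models\Phi$ if and only if $M\models_P^+\phi$.
   Context: A $\Pi_1^1$ sentence is one of the form $\forall\vec X\,\Psi$ with $\vec X$ second-order (relation or function) variables and $\Psi$ first-order, under standard (full) semantics. Syntax. Over a first-order signature $\Sigma$, the formulas of Paraconsistent Non-dependence Logic are $\psi ::= R\vec t \mid t_1=t_2 \mid {=}(\vec t_1,\vec t_2) \mid \lnot\psi \mid \psi\vee\psi \mid \exists v\,\psi$, where $\vec t,\vec t_1,\vec t_2$ are (possibly empty) tuples of $\Sigma$-terms; ${=}(\vec t_1,\vec t_2)$ is called a dependence atom. $\psi\wedge\theta$ abbreviates $\lnot(\lnot\psi\vee\lnot\theta)$ and $\forall v\,\psi$ abbreviates $\lnot\exists v\lnot\psi$. Free variables are defined as usual (all variables in an atom, including dependence atoms, are free); a sentence is a formula with no free variables. Teams. Models have nonempty domain. A team over $M$ with domain $V$ is a set $X$ of assignments $s:V\to\mathrm{Dom}(M)$. $\vec t\langle s\rangle$ denotes the value of the tuple $\vec t$ under $s$. Games. Let $\mathrm{Free}(\psi)\subseteq\mathrm{Dom}(X)$. The game $G^M_X(\psi)$ is played by Eloise and Abelard; $\alpha^*$ denotes the opponent of $\alpha$. Positions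 are triples $(\chi,s,\alpha)$ with $\chi$ an occurrence of a subformula of $\psi$, $s$ an assignment and $\alpha$ a player; the possible starting positions are $(\psi,s,\text{Eloise})$ for $s\in X$. Rules: at $(R\vec t,s,\alpha)$ or $(t_1=t_2,s,\alpha)$, $\alpha$ wins if the atom is true in $M$ under $s$, otherwise $\alpha^*$ wins; at $({=}(\vec t_1,\vec t_2),s,\alpha)$, $\alpha$ wins; from $(\lnot\chi,s,\alpha)$ the game moves to $(\chi,s,\alpha^*)$; from $(\chi\vee\theta,s,\alpha)$, $\alpha$ chooses $(\chi,s,\alpha)$ or $(\theta,s,\alpha)$; from $(\exists v\chi,s,\alpha)$, $\alpha$ chooses $m\in\mathrm{Dom}(M)$ and the game moves to $(\chi,s[m/v],\alpha)$. A (possibly nondeterministic) strategy for a player selects a nonempty set of allowed successors at each position where that player chooses; it is winning if every play from any starting position in which the player's choices conform to it is won by that player. A strategy for $\alpha$ is uniform if for any two plays conforming to it and ending in $({=}(\vec t_1,\vec t_2),s,\alpha)$ and $({=}(\vec t_1,\vec t_2),s',\alpha)$ for the same occurrence of the dependence atom, $\vec t_1\langle s\rangle=\vec t_1\langle s'\rangle$ implies $\vec t_2\langle s\rangle=\vec t_2\langle s'\rangle$. Paraconsistent satisfaction. $(M,X)\models_P^+\psi$ iff Abelard has no uniform winning strategy in $G^M_X(\psi)$; $(M,X)\models_P^-\psi$ iff Eloise has no uniform winning strategy in $G^M_X(\psi)$. For a sentence $\phi$, $M\models_P^{\pm}\phi$ means $(M,\{\emptyset\})\models_P^{\pm}\phi$,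 where $\{\emptyset\}$ is the team containing only the empty assignment. -}

module Defs where

open import Level using (Level; Lift; suc)
open import Data.Nat using (ℕ; _≟_)
open import Data.Fin using (Fin)
open import Data.List using (List; []; _∷_; length; lookup)
open import Data.List.Membership.Propositional using (_∈_)
open import Data.List.Relation.Unary.Any using (here; there)
open import Data.Vec using (Vec; []; _∷_)
open import Data.Empty using (⊥; ⊥-elim)
open import Data.Product using (Σ; _×_)
open import Data.Sum using (_⊎_; inj₁; inj₂; [_,_]′)
open import Relation.Binary.PropositionalEquality using (_≡_; _≢_)
open import Relation.Nullary using (¬_; yes; no)
open import Relation.Unary using (Pred; Satisfiable; ｛_｝)

Var : Set
Var = ℕ

-- A finite set of variables.  Order and multiplicity never matter, because
-- membership proofs are only ever used irrelevantly.
Dom : Set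
Dom = List Var

record Signature : Set₁ where
  field
    Fun      : Set
    Rel      : Set
    funArity : Fun → ℕ
    relArity : Rel → ℕ

open Signature public

data Term (S : Signature) (V : Dom) : Set where
  var : (x : Var) → .(x ∈ V) → Term S V
  app : (f : Fun S) → Vec (Term S V) (funArity S f) → Term S V

-- The domain is nonempty; constants are nullary function symbols.
record Structure (S : Signature) (ℓ : Level) : Set (suc ℓ) where
  field
    Carrier : Set ℓ
    point   : Carrier
    funᴹ    : (f : Fun S) → Vec Carrier (funArity S f) → Carrier
    relᴹ    : (R : Rel S) → Vec Carrier (relArity S R) → Set ℓ

open Structure public

------------------------------------------------------------------------
-- Assignments and teams

Assignment : ∀ {ℓ} → Set ℓ → Dom → Set ℓ
Assignment A V = (x : Var) → .(x ∈ V) → A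

∅ : ∀ {ℓ} {A : Set ℓ} → Assignment A []
∅ x ()

Team : ∀ {ℓ} → Set ℓ → Dom → Set (suc ℓ)
Team {ℓ} A V = Pred (Assignment A V) ℓ

other : ∀ {x v : Var} {V : Dom} → x ≢ v → x ∈ v ∷ V → x ∈ V
other x≢v (here x≡v)  = ⊥-elim (x≢v x≡v)
other x≢v (there x∈V) = x∈V

-- v may already belong to V, in which case its old value is overwritten.
_[_/_] : ∀ {ℓ} {A : Set ℓ} {V : Dom} →
         Assignment A V → A → (v : Var) → Assignment A (v ∷ V)
(s [ m / v ]) x x∈ with x ≟ v
... | yes _   = m
... | no  x≢v = s x (other x≢v x∈)

module _ {ℓ : Level} {S : Signature} (M : Structure S ℓ) {V : Dom} where

  mutual
    value : Assignment (Carrier M) V → Term S V → Carrier M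
    value s (var x x∈V) = s x x∈V
    value s (app f ts)  = funᴹ M f (values s ts)

    values : ∀ {n} → Assignment (Carrier M) V → Vec (Term S V) n → Vec (Carrier M) n
    values s []       = []
    values s (t ∷ ts) = value s t ∷ values s ts

------------------------------------------------------------------------
-- First-order logic and universal second-order sentences

-- FO S V: the first-order formulas with free variables among V.
data FO (S : Signature) (V : Dom) : Set where
  rel : (R : Rel S) → Vec (Term S V) (relArity S R) → FO S V
  _≐_ : Term S V → Term S V → FO S V
  neg : FO S V → FO S V
  _∨_ : FO S V → FO S V → FO S V
  ex  : (v : Var) → FO S (v ∷ V) → FO S V

_,_⊨_ : ∀ {ℓ S V} (M : Structure S ℓ) → Assignment (Carrier M) V → FO S V → Set ℓ
M , s ⊨ rel R ts = relᴹ M R (values M s ts)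
M , s ⊨ (t ≐ u)  = value M s t ≡ value M s u
M , s ⊨ neg ψ    = ¬ (M , s ⊨ ψ)
M , s ⊨ (ψ ∨ θ)  = (M , s ⊨ ψ) ⊎ (M , s ⊨ θ)
M , s ⊨ ex v ψ   = Σ (Carrier M) λ m → M , (s [ m / v ]) ⊨ ψ

-- Second-order variables are extra symbols, given by their lists of arities.
extend : Signature → List ℕ → List ℕ → Signature
extend S fs rs = record
  { Fun      = Fun S ⊎ Fin (length fs)
  ; Rel      = Rel S ⊎ Fin (length rs)
  ; funArity = [ funArity S , lookup fs ]′
  ; relArity = [ relArity S , lookup rs ]′
  }

expand : ∀ {ℓ S} (fs rs : List ℕ) (M : Structure S ℓ) →
         ((i : Fin (length fs)) → Vec (Carrier M) (lookup fs i) → Carrier M) →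
         ((i : Fin (length rs)) → Vec (Carrier M) (lookup rs i) → Set ℓ) →
         Structure (extend S fs rs) ℓ
expand fs rs M F P = record
  { Carrier = Carrier M
  ; point   = point M
  ; funᴹ    = λ { (inj₁ f) → funᴹ M f ; (inj₂ i) → F i }
  ; relᴹ    = λ { (inj₁ R) → relᴹ M R ; (inj₂ i) → P i }
  }

record Π¹₁Sentence (S : Signature) : Set where
  field
    funVars : List ℕ
    relVars : List ℕ
    matrix  : FO (extend S funVars relVars) []

_⊨Π¹₁_ : ∀ {ℓ S} → Structure S ℓ → Π¹₁Sentence S → Set (suc ℓ)
_⊨Π¹₁_ {ℓ} M Φ =
  (F : (i : Fin (length funVars)) → Vec (Carrier M) (lookup funVars i) → Carrier M)
  (P : (i : Fin (length relVars)) → Vec (Carrier M) (lookup relVars i) → Set ℓ) →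
  expand funVars relVars M F P , ∅ ⊨ matrix
  where open Π¹₁Sentence Φ

------------------------------------------------------------------------
-- Paraconsistent Non-dependence Logic

-- Formula S V: the formulas with free variables among V.
data Formula (S : Signature) (V : Dom) : Set where
  rel : (R : Rel S) → Vec (Term S V) (relArity S R) → Formula S V
  _≐_ : Term S V → Term S V → Formula S V
  dep : ∀ {m n} → Vec (Term S V) m → Vec (Term S V) n → Formula S V
  neg : Formula S V → Formula S V
  _∨_ : Formula S V → Formula S V → Formula S V
  ex  : (v : Var) → Formula S (v ∷ V) → Formula S V

Sentence : Signature → Set
Sentence S = Formula S []

-- Occ ψ χ: the occurrences of χ as a subformula of ψ, as paths from the root.
data Occ {S : Signature} {V : Dom} (ψ : Formula S V) : {W : Dom} → Formula S W → Set where
  root  : Occ ψ ψ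
  under : ∀ {W} {χ : Formula S W} → Occ ψ (neg χ) → Occ ψ χ
  left  : ∀ {W} {χ θ : Formula S W} → Occ ψ (χ ∨ θ) → Occ ψ χ
  right : ∀ {W} {χ θ : Formula S W} → Occ ψ (χ ∨ θ) → Occ ψ θ
  body  : ∀ {W v} {χ : Formula S (v ∷ W)} → Occ ψ (ex v χ) → Occ ψ χ

data Player : Set where
  Eloise Abelard : Player

_* : Player → Player
Eloise  * = Abelard
Abelard * = Eloise

module Game {ℓ : Level} {S : Signature} (M : Structure S ℓ) {V : Dom}
            (X : Team (Carrier M) V) (ψ : Formula S V) where

  record Position : Set ℓ where
    constructor ⟨_,_,_⟩
    field
      {dom}      : Dom
      {formula}  : Formula S dom
      occurrence : Occ ψ formula
      assignment : Assignment (Carrier M) dom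
      player     : Player

  data _⟶_ : Position → Position → Set ℓ where
    switch : ∀ {W} {χ : Formula S W} {o : Occ ψ (neg χ)} {s α} →
             ⟨ o , s , α ⟩ ⟶ ⟨ under o , s , α * ⟩
    goLeft : ∀ {W} {χ θ : Formula S W} {o : Occ ψ (χ ∨ θ)} {s α} →
             ⟨ o , s , α ⟩ ⟶ ⟨ left o , s , α ⟩
    goRight : ∀ {W} {χ θ : Formula S W} {o : Occ ψ (χ ∨ θ)} {s α} →
             ⟨ o , s , α ⟩ ⟶ ⟨ right o , s , α ⟩
    pick   : ∀ {W v} {χ : Formula S (v ∷ W)} {o : Occ ψ (ex v χ)} {s α}
             (m : Carrier M) →
             ⟨ o , s , α ⟩ ⟶ ⟨ body o , s [ m / v ] , α ⟩

  Terminal : Position → Set ℓ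
  Terminal p = ∀ q → ¬ (p ⟶ q)

  ChoosesAt : Player → Position → Set
  ChoosesAt β (⟨_,_,_⟩ {formula = _ ∨ _}  _ _ α) = α ≡ β
  ChoosesAt β (⟨_,_,_⟩ {formula = ex _ _} _ _ α) = α ≡ β
  ChoosesAt β _                                  = ⊥

  -- Only the atomic positions are terminal, so the last clause is never
  -- consulted for a finished play.
  WonBy : Player → Position → Set ℓ
  WonBy β (⟨_,_,_⟩ {formula = rel R ts} _ s α) =
    (β ≡ α × relᴹ M R (values M s ts)) ⊎ (β ≡ α * × ¬ relᴹ M R (values M s ts))
  WonBy β (⟨_,_,_⟩ {formula = t ≐ u} _ s α) =
    (β ≡ α × value M s t ≡ value M s u) ⊎ (β ≡ α * × value M s t ≢ value M s u)
  WonBy β (⟨_,_,_⟩ {formula = dep _ _} _ _ α) = Lift ℓ (β ≡ α)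
  WonBy β _                                   = Lift ℓ ⊥

  -- Nondeterministic; what is selected at positions where β does not choose
  -- is never consulted.
  record Strategy (β : Player) : Set (suc ℓ) where
    field
      select   : Position → Pred Position ℓ
      legal    : ∀ {p q} → ChoosesAt β p → select p q → p ⟶ q
      nonempty : ∀ {p} → ChoosesAt β p → Satisfiable (select p)

  open Strategy public

  -- PlayTo σ p: the (possibly unfinished) plays that conform to σ and have
  -- reached p.
  data PlayTo {β : Player} (σ : Strategy β) : Position → Set ℓ where
    start : ∀ {s} → X s → PlayTo σ ⟨ root , s , Eloise ⟩
    move  : ∀ {p q} → PlayTo σ p → p ⟶ q → (ChoosesAt β p → select σ p q) → PlayTo σ q

  Winning : ∀ {β} → Strategy β → Set ℓ
  Winning {β} σ = ∀ {p} → PlayTo σ p → Terminal p → WonBy β p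

  Uniform : ∀ {β} → Strategy β → Set ℓ
  Uniform {β} σ =
    ∀ {W m n} {ts : Vec (Term S W) m} {us : Vec (Term S W) n}
      {o : Occ ψ (dep ts us)} {s s′} →
    PlayTo σ ⟨ o , s , β ⟩ → PlayTo σ ⟨ o , s′ , β ⟩ →
    values M s ts ≡ values M s′ ts → values M s us ≡ values M s′ us

  HasUniformWinningStrategy : Player → Set (suc ℓ)
  HasUniformWinningStrategy β = Σ (Strategy β) λ σ → Uniform σ × Winning σ

_,_⊨ₚ⁺_ : ∀ {ℓ S V} (M : Structure S ℓ) → Team (Carrier M) V → Formula S V → Set (suc ℓ)
M , X ⊨ₚ⁺ ψ = ¬ Game.HasUniformWinningStrategy M X ψ Abelard

_⊨ₚ⁺_ : ∀ {ℓ S} → Structure S ℓ → Sentence S → Set (suc ℓ)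
M ⊨ₚ⁺ φ = M , ｛ ∅ ｝ ⊨ₚ⁺ φ

{-# OPTIONS --safe #-}

-- Abelard's uniform winning strategies are described compositionally by teams:
-- he has one iff every occurrence of a subformula can be labelled with a team
-- so that the labels of an occurrence and of its children fit together.  Such a
-- labelling is a family of relations subject to first-order conditions, so its
-- nonexistence is Π¹₁.
--
-- Conversely, a refutation of ∀F⃗P⃗ θ is a family of functions and relations:
-- F⃗ and P⃗, the truth value of every subformula of θ, the value of every term and
-- Skolem functions, all as functions of an assignment of the variables of θ.
-- The laws they obey are quantifier-free and local, each involving at most two
-- points e, e′.  Hence there is a refutation iff for some G : Aᴺ → Aᴷ a
-- quantifier-free law c(e, e′, G e, G e′) holds for all e, e′, and this is what
-- a uniform strategy of Abelard establishes in the game of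
-- ∀e e′ ∃y y′ (=(e,y) ∧ =(e′,y′) ∧ (e = e′ → y = y′) ∧ c(e,e′,y,y′)).
module Submission where

open import Defs
open import Level using (Level; Lift; lift; lower) renaming (suc to lsuc)
open import Axiom.ExcludedMiddle using (ExcludedMiddle)
open import Data.Bool using (Bool; true; false; if_then_else_)
open import Data.Empty using (⊥; ⊥-elim; ⊥-elim-irr)
open import Data.Empty.Polymorphic using () renaming (⊥ to ⊥ᵖ)
open import Data.Fin using (Fin; zero; suc; toℕ; _↑ˡ_; _↑ʳ_)
open import Data.Fin.Properties using (+↔⊎; 0↔⊥; 1↔⊤; toℕ<n) renaming (_≟_ to _≟ᶠ_)
open import Data.List using (List; []; _∷_; _++_; length; lookup; map; downFrom)
open import Data.List.Membership.DecPropositional using () renaming (_∈?_ to decide-∈)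
open import Data.List.Membership.Propositional using (_∈_)
open import Data.List.Membership.Propositional.Properties
  using (∈-++⁺ˡ; ∈-++⁺ʳ; ∈-++⁻; ∈-map⁺; ∈-lookup)
open import Data.List.Relation.Unary.Any using (here; there; index)
open import Data.List.Relation.Unary.Any.Properties using (lookup-index; ++⁻∘++⁺)
open import Data.Nat using (ℕ; zero; suc; _+_; _≟_; _<_; _≤_; _⊔_; z≤n; s≤s)
open import Data.Nat.Properties
  using (<-irrefl; n<1+n; m<n⇒m<1+n; ≤-refl; ≤-trans; <⇒≤; m⊔n≤o⇒m≤o; m⊔n≤o⇒n≤o)
open import Data.Product as Product using (Σ; ∃; _×_; _,_; proj₁; proj₂; map₁; map₂)
open import Data.Sum as Sum using (_⊎_; inj₁; inj₂; [_,_]′)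
open import Data.Sum.Function.Propositional using (_⊎-↔_)
open import Data.Unit using (⊤; tt)
open import Data.Vec as Vec using (Vec; []; _∷_)
open import Data.Vec.Properties
  using (∷-injective; lookup∘tabulate; tabulate∘lookup; tabulate-cong; lookup-++ˡ; lookup-++ʳ;
         ++-injectiveˡ; ++-injectiveʳ; take++drop≡id; map-cong; map-∘; lookup-map;
         lookup∘update; lookup∘update′)
open import Function using (_∘_; id)
open import Function.Bundles using (_⇔_; mk⇔; Equivalence; _↔_; Inverse)
open import Function.Construct.Composition using (_↔-∘_)
open import Function.Construct.Symmetry using (↔-sym)
open import Function.Properties.Inverse using (↔-refl)
open import Relation.Binary.PropositionalEquality
  using (_≡_; _≢_; _≗_; refl; sym; trans; cong; cong₂; subst)
open import Relation.Nullary using (¬_; yes; no; does)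
open import Relation.Unary using (_⊆_; ｛_｝)

open Equivalence using (to; from)

-- A play starts with Eloise as the acting player, so Abelard's strategies for a whole sentence are
-- `Win` for the player `Eloise`. Excluded middle is assumed at the level where membership in a team
-- lives, whereas labellings live one level higher. It is therefore applied to the safety of a
-- position or the truth of a formula, never to the existence of a labelling. As it decides types, a
-- positive answer carries a witness, and this is where Skolem functions come from. A label for
-- every term and subformula is what keeps a law down to two points: a Skolem form of θ itself would
-- relate as many points as θ has applications of second-order variables. Existential moves produce
-- elements, not truth values. Where the domain has two elements, equality of two outputs codes a
-- relation; on one element all equations hold, and a sign must carry the truth value instead. The
-- signs do not vary with the point, so a finite disjunction in front of all quantifiers can guess
-- them: there the team is a singleton, and disjunction is an honest choice.

-- Claim α Q: what Abelard needs of Q when α is the player asserting Q.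
Claim : ∀ {ℓ} → Player → Set ℓ → Set ℓ
Claim Abelard Q = Q
Claim Eloise  Q = ¬ Q

-- Team semantics of Abelard's uniform winning strategies.

module _ {ℓ : Level} {S : Signature} (M : Structure S ℓ) where

  private A = Carrier M

  -- Team semantics from Abelard's side: he has a uniform winning strategy from
  -- the positions (ψ, s, α) with s ∈ X.
  Win : ∀ {V} → Formula S V → Player → Team A V → Set (lsuc ℓ)
  Win (rel R ts)  α X = Lift _ (∀ {s} → X s → Claim α (relᴹ M R (values M s ts)))
  Win (t ≐ u)     α X = Lift _ (∀ {s} → X s → Claim α (value M s t ≡ value M s u))
  Win (dep ts us) Abelard X = Lift _ (∀ {s s′} → X s → X s′ →
    values M s ts ≡ values M s′ ts → values M s us ≡ values M s′ us)
  Win (dep ts us) Eloise X = Lift _ (∀ {s} → ¬ X s)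
  Win (neg ψ)     α X = Win ψ (α *) X
  Win (ψ ∨ θ)     Abelard X = Σ (Team A _) λ Y → Σ (Team A _) λ Z →
    (∀ {s} → X s → Y s ⊎ Z s) × Win ψ Abelard Y × Win θ Abelard Z
  Win (ψ ∨ θ)     Eloise X = Win ψ Eloise X × Win θ Eloise X
  Win (ex v ψ)    Abelard X = Σ (Team A _) λ Y →
    (∀ {s} → X s → ∃ λ m → Y (s [ m / v ])) × Win ψ Abelard Y
  Win (ex v ψ)    Eloise X = Σ (Team A _) λ Y →
    (∀ {s} → X s → ∀ m → Y (s [ m / v ])) × Win ψ Eloise Y

  -- Downward closure: covers are only asked to contain what they must, so the witnesses for the
  -- larger team serve the smaller one unchanged.
  win-antitone : ∀ {V} (ψ : Formula S V) {α} {X Y : Team A V} →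
                 X ⊆ Y → Win ψ α Y → Win ψ α X
  win-antitone (rel R ts) sub (lift w) = lift (w ∘ sub)
  win-antitone (t ≐ u) sub (lift w) = lift (w ∘ sub)
  win-antitone (dep ts us) {Eloise} sub (lift w) = lift (w ∘ sub)
  win-antitone (dep ts us) {Abelard} sub (lift w) = lift λ x x′ → w (sub x) (sub x′)
  win-antitone (neg ψ) sub w = win-antitone ψ sub w
  win-antitone (ψ ∨ θ) {Eloise} sub (w₁ , w₂) = win-antitone ψ sub w₁ , win-antitone θ sub w₂
  win-antitone (ψ ∨ θ) {Abelard} sub (Y , Z , c , w) = Y , Z , c ∘ sub , w
  win-antitone (ex v ψ) {Eloise} sub (Y , c , w) = Y , c ∘ sub , w
  win-antitone (ex v ψ) {Abelard} sub (Y , c , w) = Y , c ∘ sub , w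

  -- Empty-team property; it labels the disjuncts of `⋁ᵈ` that Abelard leaves aside.
  win-empty : ∀ {V} (ψ : Formula S V) α → Win ψ α (λ _ → ⊥ᵖ)
  win-empty (rel R ts) α = lift λ ()
  win-empty (t ≐ u) α = lift λ ()
  win-empty (dep ts us) Eloise = lift λ ()
  win-empty (dep ts us) Abelard = lift λ ()
  win-empty (neg ψ) α = win-empty ψ (α *)
  win-empty (ψ ∨ θ) Eloise = win-empty ψ Eloise , win-empty θ Eloise
  win-empty (ψ ∨ θ) Abelard =
    _ , _ , (λ ()) , win-empty ψ Abelard , win-empty θ Abelard
  win-empty (ex v ψ) Eloise = _ , (λ ()) , win-empty ψ Eloise
  win-empty (ex v ψ) Abelard = _ , (λ ()) , win-empty ψ Abelard

  module _ {V : Dom} (X : Team A V) (ψ : Formula S V) where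

    open Game M X ψ

    module _ (σ : Strategy Abelard) (uniform : Uniform σ) (winning : Winning σ) where

      claim-rel : ∀ {W R ts} {o : Occ ψ (rel R ts)} {s : Assignment A W} α →
                  WonBy Abelard ⟨ o , s , α ⟩ → Claim α (relᴹ M R (values M s ts))
      claim-rel Eloise  (inj₂ (_ , ¬r)) = ¬r
      claim-rel Abelard (inj₁ (_ , r))  = r

      claim-≐ : ∀ {W t u} {o : Occ ψ (t ≐ u)} {s : Assignment A W} α →
                WonBy Abelard ⟨ o , s , α ⟩ → Claim α (value M s t ≡ value M s u)
      claim-≐ Eloise  (inj₂ (_ , ¬e)) = ¬e
      claim-≐ Abelard (inj₁ (_ , e))  = e

      -- The label of an occurrence is the set of assignments with which conforming plays arrive
      -- there. Each cover condition is then a single move, and the condition at a dependence atom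
      -- is uniformity itself.
      win-reachable : ∀ {W} (χ : Formula S W) (o : Occ ψ χ) α →
                      Win χ α (λ s → PlayTo σ ⟨ o , s , α ⟩)
      win-reachable (rel R ts) o α = lift λ p → claim-rel {o = o} α (winning p (λ _ ()))
      win-reachable (t ≐ u) o α = lift λ p → claim-≐ {o = o} α (winning p (λ _ ()))
      win-reachable (dep ts us) o Eloise = lift λ p → absurd (winning p (λ _ ()))
        where absurd : ¬ Lift ℓ (Abelard ≡ Eloise)
              absurd (lift ())
      win-reachable (dep ts us) o Abelard = lift uniform
      win-reachable (neg χ) o α =
        win-antitone χ (λ p → move p switch λ ()) (win-reachable χ (under o) (α *))
      win-reachable (χ ∨ θ) o Eloise =
        win-antitone χ (λ p → move p goLeft λ ()) (win-reachable χ (left o) Eloise) ,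
        win-antitone θ (λ p → move p goRight λ ()) (win-reachable θ (right o) Eloise)
      win-reachable (χ ∨ θ) o Abelard =
        _ , _ , chosen , win-reachable χ (left o) Abelard , win-reachable θ (right o) Abelard
        where
        chosen : ∀ {s} → PlayTo σ ⟨ o , s , Abelard ⟩ →
                 PlayTo σ ⟨ left o , s , Abelard ⟩ ⊎ PlayTo σ ⟨ right o , s , Abelard ⟩
        chosen {s} p with nonempty σ {⟨ o , s , Abelard ⟩} refl
        ... | q , sel with legal σ refl sel
        ... | goLeft  = inj₁ (move p goLeft λ _ → sel)
        ... | goRight = inj₂ (move p goRight λ _ → sel)
      win-reachable (ex v χ) o Eloise =
        _ , (λ p m → move p (pick m) λ ()) , win-reachable χ (body o) Eloise
      win-reachable (ex v χ) o Abelard = _ , chosen , win-reachable χ (body o) Abelard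
        where
        chosen : ∀ {s} → PlayTo σ ⟨ o , s , Abelard ⟩ →
                 ∃ λ m → PlayTo σ ⟨ body o , s [ m / v ] , Abelard ⟩
        chosen {s} p with nonempty σ {⟨ o , s , Abelard ⟩} refl
        ... | q , sel with legal σ refl sel
        ... | pick m = m , move p (pick m) λ _ → sel

    strategy⇒win : HasUniformWinningStrategy Abelard → Win ψ Eloise X
    strategy⇒win (σ , uniform , winning) =
      win-antitone ψ start (win-reachable σ uniform winning ψ root Eloise)

    -- One label per occurrence is enough, because the negations on the path to it determine which
    -- player acts there.
    record Label {W} (χ : Formula S W) : Set (lsuc ℓ) where
      constructor label
      field
        player : Player
        team   : Team A W
        win    : Win χ player team

    open Label

    under-label : ∀ {W} {χ : Formula S W} → Label (neg χ) → Label χ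
    under-label (label α Y w) = label (α *) Y w

    left-label : ∀ {W} {χ θ : Formula S W} → Label (χ ∨ θ) → Label χ
    left-label (label Eloise Y (w , _))               = label Eloise Y w
    left-label (label Abelard _ (Y , _ , _ , w , _))  = label Abelard Y w

    right-label : ∀ {W} {χ θ : Formula S W} → Label (χ ∨ θ) → Label θ
    right-label (label Eloise Y (_ , w))              = label Eloise Y w
    right-label (label Abelard _ (_ , Z , _ , _ , w)) = label Abelard Z w

    body-label : ∀ {W v} {χ : Formula S (v ∷ W)} → Label (ex v χ) → Label χ
    body-label (label Eloise _ (Y , _ , w))  = label Eloise Y w
    body-label (label Abelard _ (Y , _ , w)) = label Abelard Y w

    module _ (em : ExcludedMiddle ℓ) (w : Win ψ Eloise X) where

      labelAt : ∀ {W} {χ : Formula S W} → Occ ψ χ → Label χ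
      labelAt root      = label Eloise X w
      labelAt (under o) = under-label (labelAt o)
      labelAt (left o)  = left-label (labelAt o)
      labelAt (right o) = right-label (labelAt o)
      labelAt (body o)  = body-label (labelAt o)

      Within : ∀ {W} {χ : Formula S W} → Label χ → Assignment A W → Player → Set ℓ
      Within L s α = α ≡ player L × team L s

      Safe : Position → Set ℓ
      Safe ⟨ o , s , α ⟩ = Within (labelAt o) s α

      within-left-or-right : ∀ {W} {χ θ : Formula S W} (L : Label (χ ∨ θ)) {s} →
        Within L s Abelard → Within (left-label L) s Abelard ⊎ Within (right-label L) s Abelard
      within-left-or-right (label Abelard _ (_ , _ , c , _)) (refl , x) =
        Sum.map (refl ,_) (refl ,_) (c x)

      within-body : ∀ {W v} {χ : Formula S (v ∷ W)} (L : Label (ex v χ)) {s} →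
        Within L s Abelard → ∃ λ m → Within (body-label L) (s [ m / v ]) Abelard
      within-body (label Abelard _ (_ , c , _)) (refl , x) = proj₁ (c x) , refl , proj₂ (c x)

      safe-move : ∀ {p} → ChoosesAt Abelard p → ∃ λ q → p ⟶ q × (Safe p → Safe q)
      safe-move {⟨_,_,_⟩ {formula = _ ∨ _} o s .Abelard} refl
        with em {Safe ⟨ o , s , Abelard ⟩}
      ... | no ¬safe = _ , goLeft , ⊥-elim ∘ ¬safe
      ... | yes safe with within-left-or-right (labelAt o) safe
      ...   | inj₁ y = _ , goLeft , λ _ → y
      ...   | inj₂ z = _ , goRight , λ _ → z
      safe-move {⟨_,_,_⟩ {formula = ex _ _} o s .Abelard} refl
        with em {Safe ⟨ o , s , Abelard ⟩}
      ... | no ¬safe = _ , pick (point M) , ⊥-elim ∘ ¬safe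
      ... | yes safe with within-body (labelAt o) safe
      ...   | m , y = _ , pick m , λ _ → y

      -- The premise `Safe p` lets an unsafe position impose nothing: no conforming play reaches it,
      -- yet `nonempty` has to offer a move there as well.
      safeStrategy : Strategy Abelard
      select   safeStrategy p q = p ⟶ q × (Safe p → Safe q)
      legal    safeStrategy _ = proj₁
      nonempty safeStrategy = safe-move

      within-under : ∀ {W} {χ : Formula S W} (L : Label (neg χ)) {s α} →
        Within L s α → Within (under-label L) s (α *)
      within-under (label _ _ _) (refl , x) = refl , x

      within-∨-Eloise : ∀ {W} {χ θ : Formula S W} (L : Label (χ ∨ θ)) {s} →
        Within L s Eloise → Within (left-label L) s Eloise × Within (right-label L) s Eloise
      within-∨-Eloise (label Eloise _ _) (refl , x) = (refl , x) , refl , x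

      within-ex-Eloise : ∀ {W v} {χ : Formula S (v ∷ W)} (L : Label (ex v χ)) {s} →
        Within L s Eloise → ∀ m → Within (body-label L) (s [ m / v ]) Eloise
      within-ex-Eloise (label Eloise _ (_ , c , _)) (refl , x) m = refl , c x m

      safe-step : ∀ {p q} → Safe p → p ⟶ q →
                  (ChoosesAt Abelard p → Safe p → Safe q) → Safe q
      safe-step safe (switch {o = o}) _ = within-under (labelAt o) safe
      safe-step safe (goLeft {o = o} {α = Eloise}) _ = proj₁ (within-∨-Eloise (labelAt o) safe)
      safe-step safe (goLeft {α = Abelard}) keep = keep refl safe
      safe-step safe (goRight {o = o} {α = Eloise}) _ = proj₂ (within-∨-Eloise (labelAt o) safe)
      safe-step safe (goRight {α = Abelard}) keep = keep refl safe
      safe-step safe (pick {o = o} {α = Eloise} m) _ = within-ex-Eloise (labelAt o) safe m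
      safe-step safe (pick {α = Abelard} m) keep = keep refl safe

      reachable-safe : ∀ {p} → PlayTo safeStrategy p → Safe p
      reachable-safe (start x)      = refl , x
      reachable-safe (move p m sel) =
        safe-step (reachable-safe p) m (λ c → proj₂ (sel c))

      safe-uniform : Uniform safeStrategy
      safe-uniform {o = o} p p′ = go (labelAt o) (reachable-safe p) (reachable-safe p′)
        where
        go : ∀ {W m n ts us} (L : Label {W} (dep {m = m} {n = n} ts us)) {s s′} →
             Within L s Abelard → Within L s′ Abelard →
             values M s ts ≡ values M s′ ts → values M s us ≡ values M s′ us
        go (label Abelard _ (lift c)) (refl , x) (refl , x′) = c x x′

      safe-winning : Winning safeStrategy
      safe-winning {⟨_,_,_⟩ {formula = rel R ts} o s α} p _ = go (labelAt o) (reachable-safe p)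
        where
        go : (L : Label (rel R ts)) → Within L s α → WonBy Abelard ⟨ o , s , α ⟩
        go (label Eloise _ (lift c)) (refl , x)  = inj₂ (refl , c x)
        go (label Abelard _ (lift c)) (refl , x) = inj₁ (refl , c x)
      safe-winning {⟨_,_,_⟩ {formula = t ≐ u} o s α} p _ = go (labelAt o) (reachable-safe p)
        where
        go : (L : Label (t ≐ u)) → Within L s α → WonBy Abelard ⟨ o , s , α ⟩
        go (label Eloise _ (lift c)) (refl , x)  = inj₂ (refl , c x)
        go (label Abelard _ (lift c)) (refl , x) = inj₁ (refl , c x)
      safe-winning {⟨_,_,_⟩ {formula = dep ts us} o s α} p _ = go (labelAt o) (reachable-safe p)
        where
        go : (L : Label (dep ts us)) → Within L s α → WonBy Abelard ⟨ o , s , α ⟩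
        go (label Eloise _ (lift c)) (refl , x)  = ⊥-elim (c x)
        go (label Abelard _ _) (refl , x) = lift refl
      safe-winning {⟨_,_,_⟩ {formula = neg _} o s α} p end = ⊥-elim (end _ switch)
      safe-winning {⟨_,_,_⟩ {formula = _ ∨ _} o s α} p end = ⊥-elim (end _ goLeft)
      safe-winning {⟨_,_,_⟩ {formula = ex _ _} o s α} p end = ⊥-elim (end _ (pick (point M)))

      win⇒strategy : HasUniformWinningStrategy Abelard
      win⇒strategy = safeStrategy , safe-uniform , safe-winning

-- Pointwise equality of assignments; assignments as tuples.

module _ {a} {A : Set a} where

  -- Assignments are functions, so equal tuples give back only this equality; everything that passes
  -- between teams and relations is transported along it.
  _≈_ : ∀ {V} → Assignment A V → Assignment A V → Set a
  _≈_ {V} s s′ = ∀ x .(x∈ : x ∈ V) → s x x∈ ≡ s′ x x∈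

  update-cong : ∀ {V} {s s′ : Assignment A V} m v → s ≈ s′ → (s [ m / v ]) ≈ (s′ [ m / v ])
  update-cong m v eq x x∈ with x ≟ v
  ... | yes _   = refl
  ... | no  x≢v = eq x (other x≢v x∈)

  update-restrict : ∀ {v V} (s : Assignment A (v ∷ V)) →
    ((λ x x∈ → s x (there x∈)) [ s v (here refl) / v ]) ≈ s
  update-restrict {v} s x x∈ with x ≟ v
  ... | yes refl = refl
  ... | no  _    = refl

  tuple : ∀ V → Assignment A V → Vec A (length V)
  tuple []      s = []
  tuple (x ∷ V) s = s x (here refl) ∷ tuple V (λ y y∈ → s y (there y∈))

  tuple-cong : ∀ V {s s′ : Assignment A V} → s ≈ s′ → tuple V s ≡ tuple V s′
  tuple-cong []      eq = refl
  tuple-cong (x ∷ V) eq =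
    cong₂ _∷_ (eq x (here refl)) (tuple-cong V λ y y∈ → eq y (there y∈))

  tuple-injective : ∀ V {s s′ : Assignment A V} → tuple V s ≡ tuple V s′ → s ≈ s′
  -- The membership proof is irrelevant and cannot be matched on; comparing variables locates x
  -- instead.
  tuple-injective (y ∷ V) eq x x∈ with x ≟ y
  ... | yes refl = proj₁ (∷-injective eq)
  ... | no  x≢y  = tuple-injective V (proj₂ (∷-injective eq)) x (other x≢y x∈)

module _ {ℓ S} (M : Structure S ℓ) where

  mutual
    value-cong : ∀ {V} {s s′ : Assignment (Carrier M) V} → s ≈ s′ →
                 ∀ t → value M s t ≡ value M s′ t
    value-cong eq (var x x∈)  = eq x x∈
    value-cong eq (app f ts) = cong (funᴹ M f) (values-cong eq ts)

    values-cong : ∀ {V} {s s′ : Assignment (Carrier M) V} → s ≈ s′ →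
                  ∀ {n} (ts : Vec _ n) → values M s ts ≡ values M s′ ts
    values-cong eq []       = refl
    values-cong eq (t ∷ ts) = cong₂ _∷_ (value-cong eq t) (values-cong eq ts)

  values-tuple : ∀ {V} (s : Assignment (Carrier M) V) W (ρ : Assignment (Term S V) W) →
                 values M s (tuple W ρ) ≡ tuple W (λ x x∈ → value M s (ρ x x∈))
  values-tuple s []      ρ = refl
  values-tuple s (x ∷ W) ρ = cong₂ _∷_ refl (values-tuple s W _)

  ⊨-cong : ∀ {V} (ψ : FO S V) {s s′} → s ≈ s′ → M , s ⊨ ψ → M , s′ ⊨ ψ
  ⊨-cong (rel R ts) eq r = subst (relᴹ M R) (values-cong eq ts) r
  ⊨-cong (t ≐ u)    eq e = trans (sym (value-cong eq t)) (trans e (value-cong eq u))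
  ⊨-cong (neg ψ)    eq n = n ∘ ⊨-cong ψ (λ x x∈ → sym (eq x x∈))
  ⊨-cong (ψ ∨ θ)    eq   = Sum.map (⊨-cong ψ eq) (⊨-cong θ eq)
  ⊨-cong (ex v ψ)   eq (m , h) = m , ⊨-cong ψ (update-cong m v eq) h

-- First-order abbreviations and their classical meaning.

module _ {S : Signature} where

  infixr 5 _⇒ᶠ_
  infixr 6 _∧ᶠ_

  _⇒ᶠ_ _∧ᶠ_ : ∀ {V} → FO S V → FO S V → FO S V
  ψ ⇒ᶠ θ = neg ψ ∨ θ
  ψ ∧ᶠ θ = neg (neg ψ ∨ neg θ)

  allᶠ : ∀ {V} v → FO S (v ∷ V) → FO S V
  allᶠ v ψ = neg (ex v (neg ψ))

  -- There is no constant for truth and possibly no term in scope, hence the quantifier.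
  trueᶠ : ∀ {V} → FO S V
  trueᶠ = allᶠ 0 (var 0 (here refl) ≐ var 0 (here refl))

  claimᶠ : ∀ {V} → Player → FO S V → FO S V
  claimᶠ Abelard ψ = ψ
  claimᶠ Eloise  ψ = neg ψ

  eqsᶠ : ∀ {V n} → Vec (Term S V) n → Vec (Term S V) n → FO S V
  eqsᶠ []       []       = trueᶠ
  eqsᶠ (t ∷ ts) (u ∷ us) = (t ≐ u) ∧ᶠ eqsᶠ ts us

  closeᶠ : ∀ V → FO S V → FO S []
  closeᶠ []      ψ = ψ
  closeᶠ (v ∷ V) ψ = closeᶠ V (allᶠ v ψ)

module _ {ℓ S} (em : ExcludedMiddle ℓ) (M : Structure S ℓ) where

  ⊨⇒ᶠ : ∀ {V s} (ψ θ : FO S V) → M , s ⊨ (ψ ⇒ᶠ θ) ⇔ (M , s ⊨ ψ → M , s ⊨ θ)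
  ⊨⇒ᶠ {s = s} ψ θ = mk⇔ (λ { (inj₁ ¬h) h → ⊥-elim (¬h h) ; (inj₂ k) _ → k }) classical
    where
    classical : (M , s ⊨ ψ → M , s ⊨ θ) → M , s ⊨ (ψ ⇒ᶠ θ)
    classical f with em {M , s ⊨ ψ}
    ... | yes h = inj₂ (f h)
    ... | no ¬h = inj₁ ¬h

  stable : {Q : Set ℓ} → ¬ ¬ Q → Q
  stable {Q} ¬¬q with em {Q}
  ... | yes q = q
  ... | no ¬q = ⊥-elim (¬¬q ¬q)

  ⊨∧ᶠ : ∀ {V s} (ψ θ : FO S V) → M , s ⊨ (ψ ∧ᶠ θ) ⇔ (M , s ⊨ ψ × M , s ⊨ θ)
  ⊨∧ᶠ ψ θ = mk⇔ (λ h → stable (h ∘ inj₁) , stable (h ∘ inj₂))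
                λ { (h , k) → [ (λ ¬h → ¬h h) , (λ ¬k → ¬k k) ]′ }

  ⊨allᶠ : ∀ {V s} v (ψ : FO S (v ∷ V)) → M , s ⊨ allᶠ v ψ ⇔ (∀ m → M , s [ m / v ] ⊨ ψ)
  ⊨allᶠ v ψ = mk⇔ (λ h m → stable λ ¬k → h (m , ¬k)) (λ h (m , ¬k) → ¬k (h m))

  ⊨claimᶠ : ∀ {V s} α (ψ : FO S V) → M , s ⊨ claimᶠ α ψ ⇔ Claim α (M , s ⊨ ψ)
  ⊨claimᶠ Abelard ψ = mk⇔ id id
  ⊨claimᶠ Eloise  ψ = mk⇔ id id

  ⊨eqsᶠ : ∀ {V s n} (ts us : Vec (Term S V) n) →
          M , s ⊨ eqsᶠ ts us ⇔ (values M s ts ≡ values M s us)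
  ⊨eqsᶠ []       []       = mk⇔ (λ _ → refl) (λ _ (m , ¬e) → ¬e refl)
  ⊨eqsᶠ (t ∷ ts) (u ∷ us) = mk⇔
    (λ h → let e , es = to (⊨∧ᶠ (t ≐ u) (eqsᶠ ts us)) h in
           cong₂ _∷_ e (to (⊨eqsᶠ ts us) es))
    (λ e → from (⊨∧ᶠ (t ≐ u) (eqsᶠ ts us))
             (proj₁ (∷-injective e) , from (⊨eqsᶠ ts us) (proj₂ (∷-injective e))))

  -- A variable listed twice is quantified twice. The inner quantifier overrides the outer one, in
  -- accordance with an assignment giving each variable a single value.
  ⊨closeᶠ : ∀ V (ψ : FO S V) → M , ∅ ⊨ closeᶠ V ψ ⇔ (∀ s → M , s ⊨ ψ)
  ⊨closeᶠ []      ψ = mk⇔ (λ h s → ⊨-cong M ψ (λ _ ()) h) (λ h → h ∅)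
  ⊨closeᶠ (v ∷ V) ψ = mk⇔
    (λ h s → ⊨-cong M ψ (update-restrict s)
      (to (⊨allᶠ v ψ) (to (⊨closeᶠ V (allᶠ v ψ)) h (λ x x∈ → s x (there x∈))) (s v (here refl))))
    (λ h → from (⊨closeᶠ V (allᶠ v ψ)) λ s → from (⊨allᶠ v ψ) λ m → h (s [ m / v ]))

-- From a sentence of the game logic to a universal second-order sentence.

-- A dependence atom compares two assignments; the even and the odd variables
-- hold one each.
double : ℕ → ℕ
double zero    = zero
double (suc n) = suc (suc (double n))

halve : ℕ → ℕ ⊎ ℕ
halve zero          = inj₁ zero
halve (suc zero)    = inj₂ zero
halve (suc (suc n)) = Sum.map suc suc (halve n)

halve-double : ∀ n → halve (double n) ≡ inj₁ n
halve-double zero    = refl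
halve-double (suc n) = cong (Sum.map suc suc) (halve-double n)

halve-suc-double : ∀ n → halve (suc (double n)) ≡ inj₂ n
halve-suc-double zero    = refl
halve-suc-double (suc n) = cong (Sum.map suc suc) (halve-suc-double n)

twice : Dom → Dom
twice V = map double V ++ map (suc ∘ double) V

module _ {a} {A : Set a} (default : A) where

  -- An irrelevant proof of membership in `twice V` cannot be taken apart into one for `V`;
  -- membership is decided afresh, and the default covers the branch that never matters.
  total : ∀ {V} → Assignment A V → Var → A
  total {V} s x with decide-∈ _≟_ x V
  ... | yes x∈ = s x x∈
  ... | no  _  = default

  total-agrees : ∀ {V} (s : Assignment A V) x .(x∈ : x ∈ V) → total s x ≡ s x x∈
  total-agrees {V} s x x∈ with decide-∈ _≟_ x V
  ... | yes _  = refl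
  ... | no x∉ = ⊥-elim-irr (x∉ x∈)

  merge : ∀ {V} → Assignment A V → Assignment A V → Assignment A (twice V)
  merge s s′ x _ = [ total s , total s′ ]′ (halve x)

-- The relations that name the teams at the proper subformulas; a negated
-- formula and Eloise's disjuncts inherit the team of the whole.
teamArities : ∀ {S V} → Formula S V → Player → List ℕ
teamArities (rel R ts)  α = []
teamArities (t ≐ u)     α = []
teamArities (dep ts us) α = []
teamArities (neg ψ)     α = teamArities ψ (α *)
teamArities (ψ ∨ θ) Eloise = teamArities ψ Eloise ++ teamArities θ Eloise
teamArities {V = V} (ψ ∨ θ) Abelard =
  length V ∷ length V ∷ teamArities ψ Abelard ++ teamArities θ Abelard
teamArities {V = V} (ex v ψ) α = length (v ∷ V) ∷ teamArities ψ α

module _ {S : Signature} (rs : List ℕ) where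

  S⁺ : Signature
  S⁺ = extend S [] rs

  -- Naming a relation variable by a proof that its arity is listed puts the arity into the type;
  -- the transport meets the `lookup` in the extended signature.
  atom : ∀ {n U} → n ∈ rs → Vec (Term S⁺ U) n → FO S⁺ U
  atom i ts = rel (inj₂ (index i)) (subst (Vec _) (lookup-index i) ts)

  mutual
    -- The substitution allows the same term to be read at either of the two assignments that a
    -- dependence atom compares.
    sub : ∀ {U V} → Assignment (Term S⁺ U) V → Term S V → Term S⁺ U
    sub ρ (var x x∈) = ρ x x∈
    sub ρ (app f ts) = app (inj₁ f) (subs ρ ts)

    subs : ∀ {U V n} → Assignment (Term S⁺ U) V → Vec (Term S V) n → Vec (Term S⁺ U) n
    subs ρ []       = []
    subs ρ (t ∷ ts) = sub ρ t ∷ subs ρ ts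

  vars : ∀ V → Assignment (Term S⁺ V) V
  vars V x x∈ = var x x∈

  evens odds : ∀ V → Assignment (Term S⁺ (twice V)) V
  evens V x x∈ = var (double x) (∈-++⁺ˡ (∈-map⁺ double x∈))
  odds  V x x∈ = var (suc (double x))
                     (∈-++⁺ʳ (map double V) (∈-map⁺ (suc ∘ double) x∈))

  member : ∀ {U} V → length V ∈ rs → Assignment (Term S⁺ U) V → FO S⁺ U
  member V T ρ = atom T (tuple V ρ)

  -- `T` names the team of ψ, and `ι` places the names of the teams below it in the complete list.
  -- With `rs` fixed throughout, no formula ever has to be weakened to a larger signature.
  translate : ∀ {V} (ψ : Formula S V) α → length V ∈ rs →
              (∀ {n} → n ∈ teamArities ψ α → n ∈ rs) → FO S⁺ []
  translate {V} (rel R ts) α T ι =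
    closeᶠ V (member V T (vars V) ⇒ᶠ claimᶠ α (rel (inj₁ R) (subs (vars V) ts)))
  translate {V} (t ≐ u) α T ι =
    closeᶠ V (member V T (vars V) ⇒ᶠ claimᶠ α (sub (vars V) t ≐ sub (vars V) u))
  translate {V} (dep ts us) Eloise T ι = closeᶠ V (neg (member V T (vars V)))
  translate {V} (dep ts us) Abelard T ι =
    closeᶠ (twice V) (member V T (evens V) ⇒ᶠ member V T (odds V) ⇒ᶠ
                      eqsᶠ (subs (evens V) ts) (subs (odds V) ts) ⇒ᶠ
                      eqsᶠ (subs (evens V) us) (subs (odds V) us))
  translate (neg ψ) α T ι = translate ψ (α *) T ι
  translate (ψ ∨ θ) Eloise T ι =
    translate ψ Eloise T (ι ∘ ∈-++⁺ˡ) ∧ᶠ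
    translate θ Eloise T (ι ∘ ∈-++⁺ʳ (teamArities ψ Eloise))
  translate {V} (ψ ∨ θ) Abelard T ι =
    closeᶠ V (member V T (vars V) ⇒ᶠ
              (member V (ι (here refl)) (vars V) ∨ member V (ι (there (here refl))) (vars V))) ∧ᶠ
    translate ψ Abelard (ι (here refl)) (ι ∘ there ∘ there ∘ ∈-++⁺ˡ) ∧ᶠ
    translate θ Abelard (ι (there (here refl)))
      (ι ∘ there ∘ there ∘ ∈-++⁺ʳ (teamArities ψ Abelard))
  translate {V} (ex v ψ) Eloise T ι =
    closeᶠ V (member V T (vars V) ⇒ᶠ
              allᶠ v (member (v ∷ V) (ι (here refl)) (vars (v ∷ V)))) ∧ᶠ
    translate ψ Eloise (ι (here refl)) (ι ∘ there)
  translate {V} (ex v ψ) Abelard T ι =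
    closeᶠ V (member V T (vars V) ⇒ᶠ
              ex v (member (v ∷ V) (ι (here refl)) (vars (v ∷ V)))) ∧ᶠ
    translate ψ Abelard (ι (here refl)) (ι ∘ there)

Interpretation : ∀ {ℓ} → Set ℓ → List ℕ → Set (lsuc ℓ)
Interpretation {ℓ} A rs = ∀ {n} → n ∈ rs → Vec A n → Set ℓ

module _ {ℓ S} (em : ExcludedMiddle ℓ) (M : Structure S ℓ) (rs : List ℕ)
         (F : (i : Fin 0) → Vec (Carrier M) (lookup [] i) → Carrier M)
         (P : (i : Fin (length rs)) → Vec (Carrier M) (lookup rs i) → Set ℓ) where

  private
    A  = Carrier M
    M⁺ = expand [] rs M F P

  ⟦_⟧ᴿ : Interpretation A rs
  ⟦ i ⟧ᴿ v = P (index i) (subst (Vec A) (lookup-index i) v)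

  values-subst : ∀ {U m n} (s : Assignment A U) (eq : m ≡ n) (ts : Vec _ m) →
    values M⁺ s (subst (Vec _) eq ts) ≡ subst (Vec A) eq (values M⁺ s ts)
  values-subst s refl ts = refl

  ⊨atom : ∀ {n U} {s : Assignment A U} (i : n ∈ rs) (ts : Vec _ n) →
          (M⁺ , s ⊨ atom rs i ts) ≡ ⟦ i ⟧ᴿ (values M⁺ s ts)
  ⊨atom {s = s} i ts = cong (P (index i)) (values-subst s (lookup-index i) ts)

  mutual
    value-sub : ∀ {U V} (s : Assignment A U) (ρ : Assignment _ V) (t : Term S V) →
      value M⁺ s (sub rs ρ t) ≡ value M (λ x x∈ → value M⁺ s (ρ x x∈)) t
    value-sub s ρ (var x x∈) = refl
    value-sub s ρ (app f ts) = cong (funᴹ M f) (values-subs s ρ ts)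

    values-subs : ∀ {U V n} (s : Assignment A U) (ρ : Assignment _ V) (ts : Vec (Term S V) n) →
      values M⁺ s (subs rs ρ ts) ≡ values M (λ x x∈ → value M⁺ s (ρ x x∈)) ts
    values-subs s ρ []       = refl
    values-subs s ρ (t ∷ ts) = cong₂ _∷_ (value-sub s ρ t) (values-subs s ρ ts)

  ⊨member : ∀ {U V} {s : Assignment A U} {s′ : Assignment A V} (T : length V ∈ rs)
            (ρ : Assignment (Term (S⁺ rs) U) V) → (λ x x∈ → value M⁺ s (ρ x x∈)) ≈ s′ →
            (M⁺ , s ⊨ member rs V T ρ) ≡ ⟦ T ⟧ᴿ (tuple V s′)
  ⊨member {V = V} {s} T ρ eq = trans (⊨atom T (tuple V ρ))
    (cong ⟦ T ⟧ᴿ (trans (values-tuple M⁺ s V ρ) (tuple-cong V eq)))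

  ⊨vars : ∀ {V} {s : Assignment A V} (T : length V ∈ rs) →
          (M⁺ , s ⊨ member rs V T (vars rs V)) ≡ ⟦ T ⟧ᴿ (tuple V s)
  ⊨vars {V} T = ⊨member T (vars rs V) (λ _ _ → refl)

  ⊨guarded : ∀ {V} (T : length V ∈ rs) (ψ : FO (S⁺ rs) V) →
    M⁺ , ∅ ⊨ closeᶠ V (member rs V T (vars rs V) ⇒ᶠ ψ) ⇔
    (∀ s → ⟦ T ⟧ᴿ (tuple V s) → M⁺ , s ⊨ ψ)
  ⊨guarded {V} T ψ = mk⇔
    (λ h s x → to (⊨⇒ᶠ em M⁺ (member rs V T (vars rs V)) ψ)
                  (to (⊨closeᶠ em M⁺ V (member rs V T (vars rs V) ⇒ᶠ ψ)) h s)
                  (subst id (sym (⊨vars T)) x))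
    (λ h → from (⊨closeᶠ em M⁺ V (member rs V T (vars rs V) ⇒ᶠ ψ)) λ s →
           from (⊨⇒ᶠ em M⁺ (member rs V T (vars rs V)) ψ) λ x → h s (subst id (⊨vars T) x))

  ⊨guarded∧ : ∀ {V} (T : length V ∈ rs) (ψ : FO (S⁺ rs) V) (θ : FO (S⁺ rs) []) →
    M⁺ , ∅ ⊨ (closeᶠ V (member rs V T (vars rs V) ⇒ᶠ ψ) ∧ᶠ θ) ⇔
    ((∀ s → ⟦ T ⟧ᴿ (tuple V s) → M⁺ , s ⊨ ψ) × M⁺ , ∅ ⊨ θ)
  ⊨guarded∧ {V} T ψ θ = mk⇔ (map₁ (to (⊨guarded T ψ)) ∘ to both)
                            (from both ∘ map₁ (from (⊨guarded T ψ)))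
    where both = ⊨∧ᶠ em M⁺ (closeᶠ V (member rs V T (vars rs V) ⇒ᶠ ψ)) θ

  ⊨claim-rel : ∀ {V s} α R (ts : Vec (Term S V) (relArity S R)) →
    M⁺ , s ⊨ claimᶠ α (rel (inj₁ R) (subs rs (vars rs V) ts)) ⇔
    Claim α (relᴹ M R (values M s ts))
  ⊨claim-rel {V} {s} α R ts = mk⇔
    (subst (Claim α) eq ∘ to (⊨claimᶠ em M⁺ α φ))
    (from (⊨claimᶠ em M⁺ α φ) ∘ subst (Claim α) (sym eq))
    where
    φ = rel (inj₁ R) (subs rs (vars rs V) ts)
    eq = cong (relᴹ M R) (values-subs s (vars rs V) ts)

  ⊨claim-≐ : ∀ {V s} α (t u : Term S V) →
    M⁺ , s ⊨ claimᶠ α (sub rs (vars rs V) t ≐ sub rs (vars rs V) u) ⇔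
    Claim α (value M s t ≡ value M s u)
  ⊨claim-≐ {V} {s} α t u = mk⇔
    (subst (Claim α) eq ∘ to (⊨claimᶠ em M⁺ α φ))
    (from (⊨claimᶠ em M⁺ α φ) ∘ subst (Claim α) (sym eq))
    where
    φ = sub rs (vars rs V) t ≐ sub rs (vars rs V) u
    eq = cong₂ _≡_ (value-sub s (vars rs V) t) (value-sub s (vars rs V) u)

  ⊨dep : ∀ {V m n} (T : length V ∈ rs) (ts : Vec (Term S V) m) (us : Vec (Term S V) n) →
    M⁺ , ∅ ⊨ translate rs (dep ts us) Abelard T (λ ()) ⇔
    (∀ s s′ → ⟦ T ⟧ᴿ (tuple V s) → ⟦ T ⟧ᴿ (tuple V s′) →
     values M s ts ≡ values M s′ ts → values M s us ≡ values M s′ us)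
  ⊨dep {V} T ts us = mk⇔ forth back
    where
    ev od : Assignment A (twice V) → Assignment A V
    ev u x x∈ = value M⁺ u (evens rs V x x∈)
    od u x x∈ = value M⁺ u (odds rs V x x∈)

    E O ts≐ us≐ : FO (S⁺ rs) (twice V)
    E = member rs V T (evens rs V)
    O = member rs V T (odds rs V)
    ts≐ = eqsᶠ (subs rs (evens rs V) ts) (subs rs (odds rs V) ts)
    us≐ = eqsᶠ (subs rs (evens rs V) us) (subs rs (odds rs V) us)

    ⊨eqs : ∀ u {k} (ws : Vec (Term S V) k) →
      M⁺ , u ⊨ eqsᶠ (subs rs (evens rs V) ws) (subs rs (odds rs V) ws) ⇔
      (values M (ev u) ws ≡ values M (od u) ws)
    ⊨eqs u ws = mk⇔
      (λ h → trans (sym (values-subs u _ ws)) (trans (to eqs h) (values-subs u _ ws)))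
      (λ h → from eqs (trans (values-subs u _ ws) (trans h (sym (values-subs u _ ws)))))
      where eqs = ⊨eqsᶠ em M⁺ (subs rs (evens rs V) ws) (subs rs (odds rs V) ws)

    back : (∀ s s′ → ⟦ T ⟧ᴿ (tuple V s) → ⟦ T ⟧ᴿ (tuple V s′) →
              values M s ts ≡ values M s′ ts → values M s us ≡ values M s′ us) →
           M⁺ , ∅ ⊨ translate rs (dep ts us) Abelard T (λ ())
    back h = from (⊨closeᶠ em M⁺ (twice V) (E ⇒ᶠ O ⇒ᶠ ts≐ ⇒ᶠ us≐)) λ u →
      from (⊨⇒ᶠ em M⁺ E (O ⇒ᶠ ts≐ ⇒ᶠ us≐)) λ x →
      from (⊨⇒ᶠ em M⁺ O (ts≐ ⇒ᶠ us≐)) λ y →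
      from (⊨⇒ᶠ em M⁺ ts≐ us≐) λ e →
      from (⊨eqs u us) (h (ev u) (od u)
        (subst id (⊨member T (evens rs V) λ _ _ → refl) x)
        (subst id (⊨member T (odds rs V) λ _ _ → refl) y)
        (to (⊨eqs u ts) e))

    forth : M⁺ , ∅ ⊨ translate rs (dep ts us) Abelard T (λ ()) →
            ∀ s s′ → ⟦ T ⟧ᴿ (tuple V s) → ⟦ T ⟧ᴿ (tuple V s′) →
            values M s ts ≡ values M s′ ts → values M s us ≡ values M s′ us
    forth h s s′ x y e =
      trans (sym (values-cong M ev≈ us)) (trans
        (to (⊨eqs u us)
          (to (⊨⇒ᶠ em M⁺ ts≐ us≐)
            (to (⊨⇒ᶠ em M⁺ O (ts≐ ⇒ᶠ us≐))
              (to (⊨⇒ᶠ em M⁺ E (O ⇒ᶠ ts≐ ⇒ᶠ us≐))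
                (to (⊨closeᶠ em M⁺ (twice V) (E ⇒ᶠ O ⇒ᶠ ts≐ ⇒ᶠ us≐)) h u)
                (subst id (sym (⊨member T (evens rs V) ev≈)) x))
              (subst id (sym (⊨member T (odds rs V) od≈)) y))
            (from (⊨eqs u ts)
              (trans (values-cong M ev≈ ts) (trans e (sym (values-cong M od≈ ts)))))))
        (values-cong M od≈ us))
      where
      u = merge (point M) s s′
      ev≈ : ev u ≈ s
      ev≈ x x∈ = trans (cong [ total (point M) s , total (point M) s′ ]′ (halve-double x))
                       (total-agrees (point M) s x x∈)
      od≈ : od u ≈ s′
      od≈ x x∈ = trans (cong [ total (point M) s , total (point M) s′ ]′ (halve-suc-double x))
                       (total-agrees (point M) s′ x x∈)

  -- A relation is read as the team of all assignments whose tuple satisfies it; the closed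
  -- conditions are then the clauses of `Win`, one for one.
  translate-sound : ∀ {V} (ψ : Formula S V) α (T : length V ∈ rs)
                    (ι : ∀ {n} → n ∈ teamArities ψ α → n ∈ rs) → M⁺ , ∅ ⊨ translate rs ψ α T ι →
                    Win M ψ α (λ s → ⟦ T ⟧ᴿ (tuple V s))
  translate-sound (rel R ts) α T ι h = lift λ {s} x →
    to (⊨claim-rel α R ts) (to (⊨guarded T (claimᶠ α _)) h s x)
  translate-sound (t ≐ u) α T ι h = lift λ {s} x →
    to (⊨claim-≐ α t u) (to (⊨guarded T (claimᶠ α _)) h s x)
  translate-sound {V} (dep ts us) Eloise T ι h = lift λ {s} x →
    to (⊨closeᶠ em M⁺ V (neg (member rs V T (vars rs V)))) h s (subst id (sym (⊨vars T)) x)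
  translate-sound (dep ts us) Abelard T ι h = lift λ {s} {s′} → to (⊨dep T ts us) h s s′
  translate-sound (neg ψ) α T ι h = translate-sound ψ (α *) T ι h
  translate-sound (ψ ∨ θ) Eloise T ι h =
    let h₁ , h₂ = to (⊨∧ᶠ em M⁺ (translate rs ψ Eloise T _) (translate rs θ Eloise T _)) h in
    translate-sound ψ Eloise T _ h₁ , translate-sound θ Eloise T _ h₂
  translate-sound {V} (ψ ∨ θ) Abelard T ι h =
    let ψ′ = translate rs ψ Abelard Y (ι ∘ there ∘ there ∘ ∈-++⁺ˡ)
        θ′ = translate rs θ Abelard Z (ι ∘ there ∘ there ∘ ∈-++⁺ʳ (teamArities ψ Abelard))
        h₀ , h′ = to (⊨guarded∧ T (member rs V Y (vars rs V) ∨ member rs V Z (vars rs V))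
                                  (ψ′ ∧ᶠ θ′)) h
        h₁ , h₂ = to (⊨∧ᶠ em M⁺ ψ′ θ′) h′ in
    _ , _ , (λ {s} x → Sum.map (subst id (⊨vars Y)) (subst id (⊨vars Z)) (h₀ s x)) ,
    translate-sound ψ Abelard Y _ h₁ , translate-sound θ Abelard Z _ h₂
    where
    Y Z : length V ∈ rs
    Y = ι (here refl)
    Z = ι (there (here refl))
  translate-sound {V} (ex v ψ) Eloise T ι h =
    let Y∙ = member rs (v ∷ V) Y (vars rs (v ∷ V))
        h₀ , h₁ = to (⊨guarded∧ T (allᶠ v Y∙) (translate rs ψ Eloise Y (ι ∘ there))) h in
    _ , (λ {s} x m → subst id (⊨vars Y) (to (⊨allᶠ em M⁺ v Y∙) (h₀ s x) m)) ,
    translate-sound ψ Eloise Y (ι ∘ there) h₁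
    where
    Y : length (v ∷ V) ∈ rs
    Y = ι (here refl)
  translate-sound {V} (ex v ψ) Abelard T ι h =
    let h₀ , h₁ = to (⊨guarded∧ T (ex v (member rs (v ∷ V) Y (vars rs (v ∷ V))))
                                  (translate rs ψ Abelard Y (ι ∘ there))) h in
    _ , (λ {s} x → let m , y = h₀ s x in m , subst id (⊨vars Y) y) ,
    translate-sound ψ Abelard Y (ι ∘ there) h₁
    where
    Y : length (v ∷ V) ∈ rs
    Y = ι (here refl)

-- A team need not be closed under `≈`, so it cannot be queried at an assignment rebuilt from a
-- tuple; the existential supplies a genuine member.
Image : ∀ {ℓ} {A : Set ℓ} {V} → Team A V → Vec A (length V) → Set ℓ
Image {V = V} X a = ∃ λ s → X s × tuple V s ≡ a

join : ∀ {ℓ} {A : Set ℓ} rs₁ {rs₂} →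
       Interpretation A rs₁ → Interpretation A rs₂ → Interpretation A (rs₁ ++ rs₂)
join rs₁ I J i = [ I , J ]′ (∈-++⁻ rs₁ i)

module _ {ℓ S} (em : ExcludedMiddle ℓ) (M : Structure S ℓ) where

  private A = Carrier M

  teams : ∀ {V} (ψ : Formula S V) α {X} → Win M ψ α X → Interpretation A (teamArities ψ α)
  teams (rel R ts)  α w ()
  teams (t ≐ u)     α w ()
  teams (dep ts us) α w ()
  teams (neg ψ)     α w = teams ψ (α *) w
  teams (ψ ∨ θ) Eloise (w₁ , w₂) =
    join (teamArities ψ Eloise) (teams ψ Eloise w₁) (teams θ Eloise w₂)
  teams (ψ ∨ θ) Abelard (Y , _ , _ , _ , _) (here refl) = Image Y
  teams (ψ ∨ θ) Abelard (_ , Z , _ , _ , _) (there (here refl)) = Image Z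
  teams (ψ ∨ θ) Abelard (_ , _ , _ , w₁ , w₂) (there (there i)) =
    join (teamArities ψ Abelard) (teams ψ Abelard w₁) (teams θ Abelard w₂) i
  teams (ex v ψ) Eloise  (Y , _ , w) (here refl) = Image Y
  teams (ex v ψ) Eloise  (Y , _ , w) (there i)   = teams ψ Eloise w i
  teams (ex v ψ) Abelard (Y , _ , w) (here refl) = Image Y
  teams (ex v ψ) Abelard (Y , _ , w) (there i)   = teams ψ Abelard w i

  module _ (rs : List ℕ)
           (F : (i : Fin 0) → Vec A (lookup [] i) → A)
           (P : (i : Fin (length rs)) → Vec A (lookup rs i) → Set ℓ) where

    private
      M⁺ = expand [] rs M F P
      ⟦_⟧ : Interpretation A rs
      ⟦_⟧ = ⟦_⟧ᴿ em M rs F P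

      Realises : ∀ {rs′} → (∀ {n} → n ∈ rs′ → n ∈ rs) → Interpretation A rs′ → Set (lsuc ℓ)
      Realises {rs′} ι J = ∀ {n} (i : n ∈ rs′) v → ⟦ ι i ⟧ v ≡ J i v

    realises-left : ∀ rs₁ {rs₂} {ι : ∀ {n} → n ∈ rs₁ ++ rs₂ → n ∈ rs}
      {I : Interpretation A rs₁} {J : Interpretation A rs₂} →
      Realises ι (join rs₁ I J) → Realises (ι ∘ ∈-++⁺ˡ) I
    realises-left rs₁ {I = I} {J} r i v =
      trans (r (∈-++⁺ˡ i) v) (cong (λ k → [ I , J ]′ k v) (++⁻∘++⁺ rs₁ (inj₁ i)))

    realises-right : ∀ rs₁ {rs₂} {ι : ∀ {n} → n ∈ rs₁ ++ rs₂ → n ∈ rs}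
      {I : Interpretation A rs₁} {J : Interpretation A rs₂} →
      Realises ι (join rs₁ I J) → Realises (ι ∘ ∈-++⁺ʳ rs₁) J
    realises-right rs₁ {I = I} {J} r i v =
      trans (r (∈-++⁺ʳ rs₁ i) v) (cong (λ k → [ I , J ]′ k v) (++⁻∘++⁺ rs₁ (inj₂ i)))

    -- The formula mentions `T` only negatively, as a guard, so one inclusion suffices for it. The
    -- teams further down are mentioned both ways and must be matched exactly, which is `Realises`.
    translate-complete : ∀ {V} (ψ : Formula S V) α {X} (w : Win M ψ α X)
      (T : length V ∈ rs) (ι : ∀ {n} → n ∈ teamArities ψ α → n ∈ rs) →
      (∀ {a} → ⟦ T ⟧ a → Image X a) → Realises ι (teams ψ α w) →
      M⁺ , ∅ ⊨ translate rs ψ α T ι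
    translate-complete (rel R ts) α (lift w) T ι sub _ =
      from (⊨guarded em M rs F P T (claimᶠ α _)) λ s x →
      from (⊨claim-rel em M rs F P α R ts)
        (let s′ , x′ , eq = sub x in
         subst (Claim α) (cong (relᴹ M R) (values-cong M (tuple-injective _ eq) ts)) (w x′))
    translate-complete (t ≐ u) α (lift w) T ι sub _ =
      from (⊨guarded em M rs F P T (claimᶠ α _)) λ s x →
      from (⊨claim-≐ em M rs F P α t u)
        (let s′ , x′ , eq = sub x in
         subst (Claim α) (cong₂ _≡_ (value-cong M (tuple-injective _ eq) t)
                                    (value-cong M (tuple-injective _ eq) u)) (w x′))
    translate-complete {V} (dep ts us) Eloise (lift w) T ι sub _ =
      from (⊨closeᶠ em M⁺ V (neg (member rs V T (vars rs V)))) λ s x →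
        w (proj₁ (proj₂ (sub (subst id (⊨vars em M rs F P T) x))))
    translate-complete (dep ts us) Abelard (lift w) T ι sub _ =
      from (⊨dep em M rs F P T ts us) λ s s′ x x′ e →
        let r , y , eq = sub x
            r′ , y′ , eq′ = sub x′
            r≈ = tuple-injective _ eq
            r′≈ = tuple-injective _ eq′ in
        trans (sym (values-cong M r≈ us)) (trans
          (w y y′ (trans (values-cong M r≈ ts) (trans e (sym (values-cong M r′≈ ts)))))
          (values-cong M r′≈ us))
    translate-complete (neg ψ) α w T ι sub re = translate-complete ψ (α *) w T ι sub re
    translate-complete (ψ ∨ θ) Eloise (w₁ , w₂) T ι sub re =
      from (⊨∧ᶠ em M⁺ (translate rs ψ Eloise T _) (translate rs θ Eloise T _))
        ( translate-complete ψ Eloise w₁ T _ sub (realises-left (teamArities ψ Eloise) re)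
        , translate-complete θ Eloise w₂ T _ sub (realises-right (teamArities ψ Eloise) re))
    translate-complete {V} (ψ ∨ θ) Abelard (Y , Z , c , w₁ , w₂) T ι sub re =
      from (⊨guarded∧ em M rs F P T (member rs V Yᵢ (vars rs V) ∨ member rs V Zᵢ (vars rs V))
             (translate rs ψ Abelard Yᵢ _ ∧ᶠ translate rs θ Abelard Zᵢ _))
        ( (λ s x → let s′ , x′ , eq = sub x in
             Sum.map (λ y → subst id (sym (⊨vars em M rs F P Yᵢ))
                              (subst id (sym (re (here refl) _)) (s′ , y , eq)))
                     (λ z → subst id (sym (⊨vars em M rs F P Zᵢ))
                              (subst id (sym (re (there (here refl)) _)) (s′ , z , eq)))
                     (c x′))
        , from (⊨∧ᶠ em M⁺ (translate rs ψ Abelard Yᵢ _) (translate rs θ Abelard Zᵢ _))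
          ( translate-complete ψ Abelard w₁ Yᵢ _ (subst id (re (here refl) _))
              (realises-left (teamArities ψ Abelard) {ι = ι ∘ there ∘ there} (re ∘ there ∘ there))
          , translate-complete θ Abelard w₂ Zᵢ _ (subst id (re (there (here refl)) _))
              (realises-right (teamArities ψ Abelard) {ι = ι ∘ there ∘ there} (re ∘ there ∘ there))))
      where
      Yᵢ Zᵢ : length V ∈ rs
      Yᵢ = ι (here refl)
      Zᵢ = ι (there (here refl))
    translate-complete {V} (ex v ψ) Eloise (Y , c , w) T ι sub re =
      from (⊨guarded∧ em M rs F P T (allᶠ v Y∙) (translate rs ψ Eloise Yᵢ _))
        ( (λ s x → let s′ , x′ , eq = sub x in
             from (⊨allᶠ em M⁺ v Y∙) λ m →
               subst id (sym (⊨vars em M rs F P Yᵢ))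
                 (subst id (sym (re (here refl) _))
                   (_ , c x′ m , tuple-cong (v ∷ V) (update-cong m v (tuple-injective V eq)))))
        , translate-complete ψ Eloise w Yᵢ _ (subst id (re (here refl) _)) (re ∘ there))
      where
      Yᵢ : length (v ∷ V) ∈ rs
      Yᵢ = ι (here refl)
      Y∙ = member rs (v ∷ V) Yᵢ (vars rs (v ∷ V))
    translate-complete {V} (ex v ψ) Abelard (Y , c , w) T ι sub re =
      from (⊨guarded∧ em M rs F P T (ex v (member rs (v ∷ V) Yᵢ (vars rs (v ∷ V))))
             (translate rs ψ Abelard Yᵢ _))
        ( (λ s x → let s′ , x′ , eq = sub x
                       m , y = c x′ in
             m , subst id (sym (⊨vars em M rs F P Yᵢ))
                   (subst id (sym (re (here refl) _))
                     (_ , y , tuple-cong (v ∷ V) (update-cong m v (tuple-injective V eq)))))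
        , translate-complete ψ Abelard w Yᵢ _ (subst id (re (here refl) _)) (re ∘ there))
      where
      Yᵢ : length (v ∷ V) ∈ rs
      Yᵢ = ι (here refl)

-- Relations are quantified by position but constructed by membership proof; the passage from one
-- indexing to the other and back loses nothing.
⟦⟧ᴿ-lookup : ∀ {ℓ S} (em : ExcludedMiddle ℓ) (M : Structure S ℓ) rs F
  (J : Interpretation (Carrier M) rs) {n} (i : n ∈ rs) v →
  ⟦_⟧ᴿ em M rs F (λ k → J (∈-lookup k)) i v ≡ J i v
⟦⟧ᴿ-lookup em M (_ ∷ rs) F J (here refl) v = refl
⟦⟧ᴿ-lookup em M (_ ∷ rs) F J (there i)   v = ⟦⟧ᴿ-lookup em M rs F (J ∘ there) i v

-- The nullary relation names the team of the root. Asserting it rules out the empty team, which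
-- would satisfy all the other conditions; the negation is there because Abelard is to have no
-- strategy.
toΠ¹₁ : ∀ {S} → Sentence S → Π¹₁Sentence S
toΠ¹₁ φ = record
  { funVars = []
  ; relVars = 0 ∷ teamArities φ Eloise
  ; matrix  = neg (atom _ (here refl) [] ∧ᶠ translate _ φ Eloise (here refl) there)
  }

toΠ¹₁-correct : ∀ {ℓ S} → ExcludedMiddle ℓ → (M : Structure S ℓ) (φ : Sentence S) →
                (M ⊨ₚ⁺ φ) ⇔ (M ⊨Π¹₁ toΠ¹₁ φ)
toΠ¹₁-correct {S = S} em M φ = mk⇔ forth back
  where
  rs = 0 ∷ teamArities φ Eloise

  start∙ : FO (extend S [] rs) []
  start∙ = atom rs (here refl) []

  forth : M ⊨ₚ⁺ φ → M ⊨Π¹₁ toΠ¹₁ φ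
  forth none F P h =
    let nonempty , steps = to (⊨∧ᶠ em (expand [] rs M F P) start∙
                                (translate rs φ Eloise (here refl) there)) h in
    none (win⇒strategy M _ φ em (win-antitone M φ (λ { refl → nonempty })
           (translate-sound em M rs F P φ Eloise (here refl) there steps)))

  back : M ⊨Π¹₁ toΠ¹₁ φ → M ⊨ₚ⁺ φ
  back valid strategy = valid F (λ k → J (∈-lookup k))
    (from (⊨∧ᶠ em (expand [] rs M F _) start∙ (translate rs φ Eloise (here refl) there))
      ( (∅ , refl , refl)
      , translate-complete em M rs F _ φ Eloise w (here refl) there id
          (λ i v → ⟦⟧ᴿ-lookup em M rs F J (there i) v)))
    where
    w = strategy⇒win M _ φ strategy
    F : (i : Fin 0) → Vec (Carrier M) (lookup [] i) → Carrier M
    F ()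
    J : Interpretation (Carrier M) rs
    J (here refl) = Image (λ s → ∅ ≡ s)
    J (there i)   = teams em M φ Eloise w i

-- Quantifier blocks and quantifier-free laws in the game logic.

-- Counting down makes the head of a vector the variable quantified last, so `a ∷ v` extends the
-- assignment of `v` by one fresh variable.
nth : ∀ {n} → Fin n → Var
nth {suc n} zero    = n
nth {suc n} (suc i) = nth i

nth-< : ∀ {n} (i : Fin n) → nth i < n
nth-< {suc n} zero    = n<1+n n
nth-< {suc n} (suc i) = m<n⇒m<1+n (nth-< i)

nth-∈ : ∀ {n} (i : Fin n) → nth i ∈ downFrom n
nth-∈ {suc n} zero    = here refl
nth-∈ {suc n} (suc i) = there (nth-∈ i)

module _ {S : Signature} where

  infixr 6 _∧ᵈ_

  _∧ᵈ_ : ∀ {V} → Formula S V → Formula S V → Formula S V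
  ψ ∧ᵈ θ = neg (neg ψ ∨ neg θ)

  allᵈ : ∀ {V} v → Formula S (v ∷ V) → Formula S V
  allᵈ v ψ = neg (ex v (neg ψ))

  -- The dependence atom on empty tuples serves as truth: as asserter Abelard meets its condition on
  -- every team, and against Eloise only on the empty one.
  ⋀ᵈ : ∀ {V n} → (Fin n → Formula S V) → Formula S V
  ⋀ᵈ {n = zero}  ψ = dep [] []
  ⋀ᵈ {n = suc n} ψ = ψ zero ∧ᵈ ⋀ᵈ (ψ ∘ suc)

  ⋁ᵈ : ∀ n {V} → (Vec Bool n → Formula S V) → Formula S V
  ⋁ᵈ zero    ψ = ψ []
  ⋁ᵈ (suc n) ψ = ⋁ᵈ n (ψ ∘ (true ∷_)) ∨ ⋁ᵈ n (ψ ∘ (false ∷_))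

  allBlock : ∀ n → Formula S (downFrom n) → Formula S []
  allBlock zero    ψ = ψ
  allBlock (suc n) ψ = allBlock n (allᵈ n ψ)

  exBlock : ∀ k {n} → Formula S (downFrom (k + n)) → Formula S (downFrom n)
  exBlock zero    ψ = ψ
  exBlock (suc k) ψ = exBlock k (ex _ ψ)

  ref : ∀ {n} → Fin n → Term S (downFrom n)
  ref i = var (nth i) (nth-∈ i)

-- A function symbol occurs only in an equation between its value at variables and a variable, since
-- each compound term will own a coordinate. `B` consists of variables for truth values, to be
-- replaced by literals.
data QF (S : Signature) (X B : Set) : Set where
  relQ  : (R : Rel S) → Vec X (relArity S R) → QF S X B
  funQ  : (f : Fun S) → Vec X (funArity S f) → X → QF S X B
  eqQ   : X → X → QF S X B
  boolQ : B → QF S X B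
  notQ  : QF S X B → QF S X B
  impQ  : QF S X B → QF S X B → QF S X B
  andQ  : QF S X B → QF S X B → QF S X B
  allQ  : ∀ {n} → (Fin n → QF S X B) → QF S X B

-- (true , x , y) is the literal x = y and (false , x , y) its negation.
Literal : Set → Set
Literal X = Bool × X × X

literalᵈ : ∀ {S V} → Literal (Term S V) → Formula S V
literalᵈ (true  , t , u) = t ≐ u
literalᵈ (false , t , u) = neg (t ≐ u)

module _ {S : Signature} {X B : Set} {V : Dom} (r : X → Term S V) (lit : B → Literal (Term S V)) where

  toFormula : QF S X B → Formula S V
  toFormula (relQ R xs)   = rel R (Vec.map r xs)
  toFormula (funQ f xs y) = app f (Vec.map r xs) ≐ r y
  toFormula (eqQ x y)     = r x ≐ r y
  toFormula (boolQ b)     = literalᵈ (lit b)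
  toFormula (notQ c)      = neg (toFormula c)
  toFormula (impQ c d)    = neg (toFormula c) ∨ toFormula d
  toFormula (andQ c d)    = toFormula c ∧ᵈ toFormula d
  toFormula (allQ c)      = ⋀ᵈ (λ i → toFormula (c i))

Signed : ∀ {a} → Bool → Set a → Set a
Signed true  Q = Q
Signed false Q = ¬ Q

HoldsL : ∀ {a} {A : Set a} {X : Set} → (X → A) → Literal X → Set a
HoldsL ρ (β , x , y) = Signed β (ρ x ≡ ρ y)

HoldsL-cong : ∀ {a} {A : Set a} {X : Set} {ρ ρ′ : X → A} → ρ ≗ ρ′ →
              ∀ l → HoldsL ρ l ⇔ HoldsL ρ′ l
HoldsL-cong eq (β , x , y) =
  mk⇔ (subst id (cong (Signed β) (cong₂ _≡_ (eq x) (eq y))))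
      (subst id (sym (cong (Signed β) (cong₂ _≡_ (eq x) (eq y)))))

module _ {ℓ S} (M : Structure S ℓ) {X B : Set} where

  ⟦_⟧ : QF S X B → (X → Carrier M) → (B → Set ℓ) → Set ℓ
  ⟦ relQ R xs ⟧   ρ τ = relᴹ M R (Vec.map ρ xs)
  ⟦ funQ f xs y ⟧ ρ τ = funᴹ M f (Vec.map ρ xs) ≡ ρ y
  ⟦ eqQ x y ⟧     ρ τ = ρ x ≡ ρ y
  ⟦ boolQ b ⟧     ρ τ = τ b
  ⟦ notQ c ⟧      ρ τ = ¬ ⟦ c ⟧ ρ τ
  ⟦ impQ c d ⟧    ρ τ = ⟦ c ⟧ ρ τ → ⟦ d ⟧ ρ τ
  ⟦ andQ c d ⟧    ρ τ = ⟦ c ⟧ ρ τ × ⟦ d ⟧ ρ τ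
  ⟦ allQ c ⟧      ρ τ = ∀ i → ⟦ c i ⟧ ρ τ

  ⟦⟧-cong : ∀ (c : QF S X B) {ρ ρ′ τ τ′} → ρ ≗ ρ′ → (∀ b → τ b ⇔ τ′ b) →
            ⟦ c ⟧ ρ τ ⇔ ⟦ c ⟧ ρ′ τ′
  ⟦⟧-cong (relQ R xs) eq iff =
    mk⇔ (subst (relᴹ M R) (map-cong eq xs)) (subst (relᴹ M R) (sym (map-cong eq xs)))
  ⟦⟧-cong (funQ f xs y) eq iff = mk⇔
    (λ e → trans (cong (funᴹ M f) (sym (map-cong eq xs))) (trans e (eq y)))
    (λ e → trans (cong (funᴹ M f) (map-cong eq xs)) (trans e (sym (eq y))))
  ⟦⟧-cong (eqQ x y) eq iff = mk⇔
    (λ e → trans (sym (eq x)) (trans e (eq y)))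
    (λ e → trans (eq x) (trans e (sym (eq y))))
  ⟦⟧-cong (boolQ b) eq iff = iff b
  ⟦⟧-cong (notQ c) eq iff =
    let c⇔ = ⟦⟧-cong c eq iff in mk⇔ (_∘ from c⇔) (_∘ to c⇔)
  ⟦⟧-cong (impQ c d) eq iff =
    let c⇔ = ⟦⟧-cong c eq iff ; d⇔ = ⟦⟧-cong d eq iff in
    mk⇔ (λ h → to d⇔ ∘ h ∘ from c⇔) (λ h → from d⇔ ∘ h ∘ to c⇔)
  ⟦⟧-cong (andQ c d) eq iff =
    let c⇔ = ⟦⟧-cong c eq iff ; d⇔ = ⟦⟧-cong d eq iff in
    mk⇔ (λ (h , k) → to c⇔ h , to d⇔ k) (λ (h , k) → from c⇔ h , from d⇔ k)
  ⟦⟧-cong (allQ c) eq iff = mk⇔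
    (λ h i → to (⟦⟧-cong (c i) eq iff) (h i))
    (λ h i → from (⟦⟧-cong (c i) eq iff) (h i))

-- Flat formulas, and Abelard's strategies for quantifier blocks.

module _ {ℓ S} (em : ExcludedMiddle ℓ) (M : Structure S ℓ) where

  private A = Carrier M

  -- Flatness in the sense of team semantics: a team satisfies the formula when each of its members
  -- does. Both players are treated together because negation exchanges them.
  record Flat {V} (ψ : Formula S V) (Q : Assignment A V → Set ℓ) : Set (lsuc ℓ) where
    constructor mkFlat
    field
      flatness : ∀ α X → Win M ψ α X ⇔ (∀ {s} → X s → Claim α (Q s))

  open Flat public

  claim-⇔ : ∀ α {Q R : Set ℓ} → Q ⇔ R → Claim α Q → Claim α R
  claim-⇔ Abelard iff q  = to iff q
  claim-⇔ Eloise  iff ¬q = ¬q ∘ from iff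

  module _ {V : Dom} where

    flat-resp : ∀ {ψ : Formula S V} {Q R} → (∀ s → Q s ⇔ R s) → Flat ψ Q → Flat ψ R
    flatness (flat-resp iff flat) α X = mk⇔
      (λ w {s} x → claim-⇔ α (iff s) (to (flatness flat α X) w x))
      (λ h → from (flatness flat α X) λ {s} x →
        claim-⇔ α (mk⇔ (from (iff s)) (to (iff s))) (h x))

    flat-rel : ∀ R (ts : Vec (Term S V) _) → Flat (rel R ts) (λ s → relᴹ M R (values M s ts))
    flatness (flat-rel R ts) α X = mk⇔ lower lift

    flat-≐ : ∀ (t u : Term S V) → Flat (t ≐ u) (λ s → value M s t ≡ value M s u)
    flatness (flat-≐ t u) α X = mk⇔ lower lift

    flat-neg : ∀ {ψ : Formula S V} {Q} → Flat ψ Q → Flat (neg ψ) (λ s → ¬ Q s)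
    flatness (flat-neg flat) Abelard X = flatness flat Eloise X
    flatness (flat-neg flat) Eloise  X = mk⇔
      (λ w {s} x ¬q → ¬q (to (flatness flat Abelard X) w x))
      (λ h → from (flatness flat Abelard X) λ {s} x → stable em M (h x))

    flat-∨ : ∀ {ψ θ : Formula S V} {Q R} → Flat ψ Q → Flat θ R → Flat (ψ ∨ θ) (λ s → Q s ⊎ R s)
    flatness (flat-∨ flat₁ flat₂) Eloise X = mk⇔
      (λ (w₁ , w₂) {s} x → [ to (flatness flat₁ Eloise X) w₁ x , to (flatness flat₂ Eloise X) w₂ x ]′)
      (λ h → from (flatness flat₁ Eloise X) (λ {s} x → h x ∘ inj₁) ,
             from (flatness flat₂ Eloise X) (λ {s} x → h x ∘ inj₂))
    flatness (flat-∨ {Q = Q} {R} flat₁ flat₂) Abelard X = mk⇔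
      (λ (Y , Z , c , w₁ , w₂) {s} x →
        Sum.map (to (flatness flat₁ Abelard Y) w₁) (to (flatness flat₂ Abelard Z) w₂) (c x))
      -- The teams of a cover may stick out of X, so the truth sets of the disjuncts serve.
      (λ h → Q , R , h , from (flatness flat₁ Abelard Q) id , from (flatness flat₂ Abelard R) id)

    flat-→ : ∀ {ψ θ : Formula S V} {Q R} → Flat ψ Q → Flat θ R →
             Flat (neg ψ ∨ θ) (λ s → Q s → R s)
    flat-→ {Q = Q} {R} flat₁ flat₂ = flat-resp
      (λ s → mk⇔ [ (λ ¬q q → ⊥-elim (¬q q)) , (λ r _ → r) ]′ (dec s))
                                               (flat-∨ (flat-neg flat₁) flat₂)
      where
      dec : ∀ s → (Q s → R s) → ¬ Q s ⊎ R s
      dec s f with em {Q s}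
      ... | yes q = inj₂ (f q)
      ... | no ¬q = inj₁ ¬q

    flat-∧ : ∀ {ψ θ : Formula S V} {Q R} → Flat ψ Q → Flat θ R →
             Flat (ψ ∧ᵈ θ) (λ s → Q s × R s)
    flat-∧ flat₁ flat₂ = flat-resp
      (λ s → mk⇔ (λ h → stable em M (h ∘ inj₁) , stable em M (h ∘ inj₂))
                 λ (q , r) → [ (λ ¬q → ¬q q) , (λ ¬r → ¬r r) ]′)
      (flat-neg (flat-∨ (flat-neg flat₁) (flat-neg flat₂)))

    flat-⋀ : ∀ {n} {ψ : Fin n → Formula S V} {Q : Fin n → Assignment A V → Set ℓ} →
             (∀ i → Flat (ψ i) (Q i)) → Flat (⋀ᵈ ψ) (λ s → ∀ i → Q i s)
    flat-⋀ {zero} flat = mkFlat λ where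
      Abelard X → mk⇔ (λ _ {s} _ ()) (λ _ → lift λ {_} {_} _ _ _ → refl)
      Eloise  X → mk⇔ (λ (lift w) {s} x → ⊥-elim (w x)) (λ h → lift λ {s} x → h x λ ())
    flat-⋀ {suc n} flat = flat-resp
      (λ s → mk⇔ (λ { (q , qs) zero → q ; (q , qs) (suc i) → qs i })
                 (λ h → h zero , h ∘ suc))
      (flat-∧ (flat zero) (flat-⋀ (flat ∘ suc)))

    values-map : ∀ {X : Set} (r : X → Term S V) s {n} (xs : Vec X n) →
                 values M s (Vec.map r xs) ≡ Vec.map (λ x → value M s (r x)) xs
    values-map r s []       = refl
    values-map r s (x ∷ xs) = cong (_ ∷_) (values-map r s xs)

    flat-literal : ∀ (l : Literal (Term S V)) → Flat (literalᵈ l) (λ s → HoldsL (value M s) l)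
    flat-literal (true  , t , u) = flat-≐ t u
    flat-literal (false , t , u) = flat-neg (flat-≐ t u)

    module _ {X B : Set} (r : X → Term S V) (lit : B → Literal (Term S V)) where

      flat-toFormula : ∀ (c : QF S X B) →
        Flat (toFormula r lit c) (λ s → ⟦_⟧ M c (value M s ∘ r) (HoldsL (value M s) ∘ lit))
      flat-toFormula (relQ R xs) = flat-resp
        (λ s → mk⇔ (subst (relᴹ M R) (values-map r s xs)) (subst (relᴹ M R) (sym (values-map r s xs))))
        (flat-rel R (Vec.map r xs))
      flat-toFormula (funQ f xs y) = flat-resp
        (λ s → mk⇔ (trans (cong (funᴹ M f) (sym (values-map r s xs))))
                   (trans (cong (funᴹ M f) (values-map r s xs))))
        (flat-≐ (app f (Vec.map r xs)) (r y))
      flat-toFormula (eqQ x y)  = flat-≐ (r x) (r y)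
      flat-toFormula (boolQ b)  = flat-literal (lit b)
      flat-toFormula (notQ c)   = flat-neg (flat-toFormula c)
      flat-toFormula (impQ c d) = flat-→ (flat-toFormula c) (flat-toFormula d)
      flat-toFormula (andQ c d) = flat-∧ (flat-toFormula c) (flat-toFormula d)
      flat-toFormula (allQ c)   = flat-⋀ (λ i → flat-toFormula (c i))

  -- In general a disjunction splits the team and may use several disjuncts; the single member of a
  -- singleton falls on one side, and downward closure does the rest.
  win-⋁ : ∀ n {V} {ψ : Vec Bool n → Formula S V} {s₀} →
          Win M (⋁ᵈ n ψ) Abelard (λ s → s₀ ≡ s) ⇔
          (∃ λ β → Win M (ψ β) Abelard (λ s → s₀ ≡ s))
  win-⋁ zero = mk⇔ ([] ,_) λ { ([] , w) → w }
  win-⋁ (suc n) {ψ = ψ} {s₀} = mk⇔ forth back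
    where
    forth : Win M (⋁ᵈ (suc n) ψ) Abelard (λ s → s₀ ≡ s) →
            ∃ λ β → Win M (ψ β) Abelard (λ s → s₀ ≡ s)
    forth (Y , Z , c , w₁ , w₂) with c refl
    ... | inj₁ y = let β , w = to (win-⋁ n)
                                 (win-antitone M (⋁ᵈ n (ψ ∘ (true ∷_))) (λ { refl → y }) w₁) in
                   true ∷ β , w
    ... | inj₂ z = let β , w = to (win-⋁ n)
                                 (win-antitone M (⋁ᵈ n (ψ ∘ (false ∷_))) (λ { refl → z }) w₂) in
                   false ∷ β , w
    back : (∃ λ β → Win M (ψ β) Abelard (λ s → s₀ ≡ s)) →
           Win M (⋁ᵈ (suc n) ψ) Abelard (λ s → s₀ ≡ s)
    back (true ∷ β , w)  = _ , _ , inj₁ , from (win-⋁ n) (β , w) ,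
      win-empty M (⋁ᵈ n (ψ ∘ (false ∷_))) Abelard
    back (false ∷ β , w) = _ , _ , inj₂ , win-empty M (⋁ᵈ n (ψ ∘ (true ∷_))) Abelard ,
      from (win-⋁ n) (β , w)

  assign : ∀ {n} → Vec A n → Assignment A (downFrom n)
  assign []              = ∅
  assign {suc n} (a ∷ v) = assign v [ a / n ]

  value-ref : ∀ {n} (v : Vec A n) i → value M (assign v) (ref i) ≡ Vec.lookup v i
  value-ref {suc n} (a ∷ v) zero with n ≟ n
  ... | yes _  = refl
  ... | no n≢n = ⊥-elim (n≢n refl)
  value-ref {suc n} (a ∷ v) (suc i) with nth i ≟ n
  ... | yes i≡n = ⊥-elim (<-irrefl i≡n (nth-< i))
  ... | no _    = value-ref v i

  -- Members are required to be equal to an assignment built by `assign`, not just `≈` to one, so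
  -- that matching on the proof exposes the vector.
  Full : ∀ n → Team A (downFrom n)
  Full n s = ∃ λ (v : Vec A n) → assign v ≡ s

  Graph : ∀ {k n} → (Vec A n → Vec A k) → Team A (downFrom (k + n))
  Graph g s = ∃ λ v → assign (g v Vec.++ v) ≡ s

  win-allBlock : ∀ n (ψ : Formula S (downFrom n)) →
    Win M (allBlock n ψ) Abelard ｛ ∅ ｝ ⇔ Win M ψ Abelard (Full n)
  win-allBlock zero ψ = mk⇔ (win-antitone M ψ λ { ([] , eq) → eq })
                            (win-antitone M ψ λ eq → [] , eq)
  win-allBlock (suc n) ψ = mk⇔
    (λ w → let Y , c , w′ = to (win-allBlock n (allᵈ n ψ)) w in
           win-antitone M ψ (λ { (a ∷ v , refl) → c (v , refl) a }) w′)
    (λ w → from (win-allBlock n (allᵈ n ψ))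
             (Full (suc n) , (λ { (v , refl) a → a ∷ v , refl }) , w))

  -- Abelard may admit several values at once; keeping the one that the cover exhibits thins his
  -- choice to a function, by downward closure. So far this function sees the entire input vector.
  win-exBlock : ∀ k {n} (ψ : Formula S (downFrom (k + n))) →
    Win M (exBlock k ψ) Abelard (Full n) ⇔
    (∃ λ (g : Vec A n → Vec A k) → Win M ψ Abelard (Graph g))
  win-exBlock zero ψ = mk⇔ (λ w → (λ _ → []) , w)
    (λ (g , w) → win-antitone M ψ (λ (v , eq) → v , trans (nil (g v) v) eq) w)
    where
    nil : ∀ {n} (u : Vec A 0) (v : Vec A n) → assign (u Vec.++ v) ≡ assign v
    nil [] v = refl
  win-exBlock (suc k) {n} ψ = mk⇔
    (λ w → let g , Y , c , w′ = to (win-exBlock k (ex (k + n) ψ)) w in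
           (λ v → proj₁ (c (v , refl)) ∷ g v) ,
           win-antitone M ψ (λ { (v , refl) → proj₂ (c (v , refl)) }) w′)
    (λ (g , w) → from (win-exBlock k (ex (k + n) ψ))
      ( Vec.tail ∘ g , Graph g
      , (λ { (v , refl) → Vec.head (g v) , v , cons (g v) v })
      , w))
    where
    cons : ∀ (u : Vec A (suc k)) (v : Vec A n) →
           assign (u Vec.++ v) ≡ assign (Vec.tail u Vec.++ v) [ Vec.head u / k + n ]
    cons (_ ∷ _) v = refl

-- Two samples of one function.

half : ∀ {a} {A : Set a} {n} → Bool → Vec A (n + n) → Vec A n
half {n = n} false v = Vec.take n v
half {n = n} true  v = Vec.drop n v

pair : ∀ {a} {A : Set a} {n} → (Bool → Vec A n) → Vec A (n + n)
pair e = e false Vec.++ e true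

half-pair : ∀ {a} {A : Set a} {n} (e : Bool → Vec A n) p → half p (pair e) ≡ e p
half-pair {n = n} e false = ++-injectiveˡ _ _ (take++drop≡id n (pair e))
half-pair {n = n} e true  = ++-injectiveʳ (Vec.take n (pair e)) _ (take++drop≡id n (pair e))

module _ (N K : ℕ) where

  -- (p , inj₁ i) is the i-th coordinate of the p-th point and (p , inj₂ k) the
  -- k-th coordinate of the value of the quantified function there.
  Location : Set
  Location = Bool × (Fin N ⊎ Fin K)

  environment : ∀ {a} {A : Set a} → (Bool → Vec A N) → (Bool → Vec A K) → Location → A
  environment e y (p , inj₁ i) = Vec.lookup (e p) i
  environment e y (p , inj₂ k) = Vec.lookup (y p) k

  module _ {S : Signature} where

    -- Outputs come before inputs because they are quantified later; within each block the sample
    -- `false` comes first.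
    locate : Location → Term S (downFrom ((K + K) + (N + N)))
    locate (false , inj₁ i) = ref ((K + K) ↑ʳ (i ↑ˡ N))
    locate (true  , inj₁ i) = ref ((K + K) ↑ʳ (N ↑ʳ i))
    locate (false , inj₂ k) = ref ((k ↑ˡ K) ↑ˡ (N + N))
    locate (true  , inj₂ k) = ref ((K ↑ʳ k) ↑ˡ (N + N))

    inputs : Bool → Vec (Term S _) N
    inputs p = Vec.tabulate (λ i → locate (p , inj₁ i))

    outputs : Bool → Vec (Term S _) K
    outputs p = Vec.tabulate (λ k → locate (p , inj₂ k))

    -- The two dependence atoms only say that each of the two samples comes from
    -- some function; this makes the functions equal.
    sameFunction : QF S Location ⊥
    sameFunction = impQ (allQ λ i → eqQ (false , inj₁ i) (true , inj₁ i))
                        (allQ λ k → eqQ (false , inj₂ k) (true , inj₂ k))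

    twoPoint : ∀ {X B} → (X → Location) → (B → Literal Location) → QF S X B → Formula S []
    twoPoint loc lit c = allBlock (N + N) (exBlock (K + K)
      (dep (inputs false) (outputs false) ∧ᵈ dep (inputs true) (outputs true) ∧ᵈ
       toFormula locate (λ ()) sameFunction ∧ᵈ
       toFormula (locate ∘ loc) (λ b → map₂ (Product.map locate locate) (lit b)) c))

module _ {ℓ S} (em : ExcludedMiddle ℓ) (M : Structure S ℓ) (N K : ℕ) where

  private
    A = Carrier M

    state : Vec A (K + K) → Vec A (N + N) → Assignment A (downFrom ((K + K) + (N + N)))
    state u v = assign em M (u Vec.++ v)

    halves : ∀ {n} → Vec A (n + n) → Bool → Vec A n
    halves v p = half p v

  lookup-take : ∀ n (v : Vec A (n + n)) i → Vec.lookup v (i ↑ˡ n) ≡ Vec.lookup (Vec.take n v) i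
  lookup-take n v i =
    trans (cong (λ w → Vec.lookup w (i ↑ˡ n)) (sym (take++drop≡id n v)))
          (lookup-++ˡ (Vec.take n v) (Vec.drop n v) i)

  lookup-drop : ∀ n (v : Vec A (n + n)) i → Vec.lookup v (n ↑ʳ i) ≡ Vec.lookup (Vec.drop n v) i
  lookup-drop n v i =
    trans (cong (λ w → Vec.lookup w (n ↑ʳ i)) (sym (take++drop≡id n v)))
          (lookup-++ʳ (Vec.take n v) (Vec.drop n v) i)

  value-locate : ∀ u v → value M (state u v) ∘ locate N K ≗ environment N K (halves v) (halves u)
  value-locate u v (false , inj₁ i) =
    trans (value-ref em M (u Vec.++ v) _) (trans (lookup-++ʳ u v _) (lookup-take N v i))
  value-locate u v (true  , inj₁ i) =
    trans (value-ref em M (u Vec.++ v) _) (trans (lookup-++ʳ u v _) (lookup-drop N v i))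
  value-locate u v (false , inj₂ k) =
    trans (value-ref em M (u Vec.++ v) _) (trans (lookup-++ˡ u v _) (lookup-take K u k))
  value-locate u v (true  , inj₂ k) =
    trans (value-ref em M (u Vec.++ v) _) (trans (lookup-++ˡ u v _) (lookup-drop K u k))

  values-tabulate : ∀ {V n} (s : Assignment A V) (f : Fin n → Term S V) →
                    values M s (Vec.tabulate f) ≡ Vec.tabulate (value M s ∘ f)
  values-tabulate {n = zero}  s f = refl
  values-tabulate {n = suc n} s f = cong₂ _∷_ refl (values-tabulate s (f ∘ suc))

  values-inputs : ∀ u v p → values M (state u v) (inputs N K p) ≡ half p v
  values-inputs u v p = trans (values-tabulate _ (λ i → locate N K (p , inj₁ i)))
    (trans (tabulate-cong (λ i → value-locate u v (p , inj₁ i))) (tabulate∘lookup _))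

  values-outputs : ∀ u v p → values M (state u v) (outputs N K p) ≡ half p u
  values-outputs u v p = trans (values-tabulate _ (λ k → locate N K (p , inj₂ k)))
    (trans (tabulate-cong (λ k → value-locate u v (p , inj₂ k))) (tabulate∘lookup _))

  lookup-ext : ∀ {n} {v w : Vec A n} → Vec.lookup v ≗ Vec.lookup w → v ≡ w
  lookup-ext {v = v} {w} eq =
    trans (sym (tabulate∘lookup v)) (trans (tabulate-cong eq) (tabulate∘lookup w))

  module _ {X B : Set} (loc : X → Location N K) (lit : B → Literal (Location N K))
           (c : QF S X B) where

    private
      lit′ : B → Literal (Term S _)
      lit′ b = map₂ (Product.map (locate N K) (locate N K)) (lit b)

      same = flat-toFormula em M (locate N K) (λ ()) (sameFunction N K)
      flat = flat-toFormula em M (locate N K ∘ loc) lit′ c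

    Meaning : (Bool → Vec A N) → (Bool → Vec A K) → Set ℓ
    Meaning e y = ⟦_⟧ M c (environment N K e y ∘ loc) (HoldsL (environment N K e y) ∘ lit)

    meaning-cong : ∀ {s} {e y} → value M s ∘ locate N K ≗ environment N K e y →
      ⟦_⟧ M c (value M s ∘ locate N K ∘ loc) (HoldsL (value M s) ∘ lit′) ⇔ Meaning e y
    meaning-cong eq = ⟦⟧-cong M c (eq ∘ loc) (λ b → HoldsL-cong eq (lit b))

    environment-cong : ∀ {e e′ : Bool → Vec A N} {y y′ : Bool → Vec A K} →
      e ≗ e′ → y ≗ y′ → environment N K e y ≗ environment N K e′ y′
    environment-cong e≗ y≗ (p , inj₁ i) = cong (λ v → Vec.lookup v i) (e≗ p)
    environment-cong e≗ y≗ (p , inj₂ k) = cong (λ v → Vec.lookup v k) (y≗ p)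

    -- The dependence atoms make each half of `g v` a function of the corresponding half of `v`
    -- alone, and agreement on the diagonal identifies the two functions. Conversely, G applied to
    -- both halves is a strategy.
    win-twoPoint : Win M (twoPoint N K loc lit c) Abelard ｛ ∅ ｝ ⇔
                   (∃ λ (G : Vec A N → Vec A K) → ∀ e → Meaning e (G ∘ e))
    win-twoPoint = mk⇔ forth back
      where
      forth : Win M (twoPoint N K loc lit c) Abelard ｛ ∅ ｝ →
              ∃ λ (G : Vec A N → Vec A K) → ∀ e → Meaning e (G ∘ e)
      forth w with to (win-exBlock em M (K + K) _) (to (win-allBlock em M (N + N) _) w)
      ... | g , lift dep₀ , lift dep₁ , wsame , wc = G , meaning
        where
        out : Bool → Vec A (N + N) → Vec A K
        out p v = half p (g v)

        functional : ∀ p v v′ → half p v ≡ half p v′ → out p v ≡ out p v′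
        functional p v v′ eq = trans (sym (values-outputs (g v) v p)) (trans
          (uniform p (trans (values-inputs (g v) v p) (trans eq (sym (values-inputs (g v′) v′ p)))))
          (values-outputs (g v′) v′ p))
          where
          uniform : ∀ p →
            values M (state (g v) v) (inputs N K p) ≡ values M (state (g v′) v′) (inputs N K p) →
            values M (state (g v) v) (outputs N K p) ≡ values M (state (g v′) v′) (outputs N K p)
          uniform false = dep₀ (v , refl) (v′ , refl)
          uniform true  = dep₁ (v , refl) (v′ , refl)

        diagonal : ∀ v → half false v ≡ half true v → out false v ≡ out true v
        diagonal v eq = lookup-ext λ k →
          trans (sym (value-locate (g v) v (false , inj₂ k))) (trans
            (to (flatness same Abelard (Graph em M g)) wsame (v , refl)
              (λ i → trans (value-locate (g v) v (false , inj₁ i))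
                (trans (cong (λ u → Vec.lookup u i) eq) (sym (value-locate (g v) v (true , inj₁ i)))))
              k)
            (value-locate (g v) v (true , inj₂ k)))

        G : Vec A N → Vec A K
        -- The second half does not affect this output; repeating e there is what lets `diagonal`
        -- compare it with the other one.
        G e = out false (e Vec.++ e)

        twin : ∀ e p → half p (e Vec.++ e) ≡ e
        twin e = half-pair (λ _ → e)

        out-G : ∀ p v → out p v ≡ G (half p v)
        out-G false v = functional false v _ (sym (twin _ false))
        -- The second sample reaches G by way of the diagonal: first replace the other input by e,
        -- then switch outputs.
        out-G true  v = trans (functional true v (e Vec.++ e) (sym (twin e true)))
                              (sym (diagonal (e Vec.++ e) (trans (twin e false) (sym (twin e true)))))
          where e = half true v

        meaning : ∀ e → Meaning e (G ∘ e)
        meaning e = to (meaning-cong λ l → trans (value-locate (g v) v l)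
            (environment-cong (half-pair e) (λ p → trans (out-G p v) (cong G (half-pair e p))) l))
          (to (flatness flat Abelard (Graph em M g)) wc (v , refl))
          where v = pair e

      back : (∃ λ (G : Vec A N → Vec A K) → ∀ e → Meaning e (G ∘ e)) →
             Win M (twoPoint N K loc lit c) Abelard ｛ ∅ ｝
      back (G , meaning) = from (win-allBlock em M (N + N) _) (from (win-exBlock em M (K + K) _)
        (g , lift (λ {_} {_} → uniform false) , lift (λ {_} {_} → uniform true) ,
         from (flatness same Abelard (Graph em M g)) same-G ,
         from (flatness flat Abelard (Graph em M g)) meaning-G))
        where
        g : Vec A (N + N) → Vec A (K + K)
        g v = pair (G ∘ halves v)

        locate-G : ∀ v → value M (state (g v) v) ∘ locate N K ≗
                         environment N K (halves v) (G ∘ halves v)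
        locate-G v l = trans (value-locate (g v) v l)
          (environment-cong (λ _ → refl) (half-pair (G ∘ halves v)) l)

        uniform : ∀ p {s s′} → Graph em M g s → Graph em M g s′ →
          values M s (inputs N K p) ≡ values M s′ (inputs N K p) →
          values M s (outputs N K p) ≡ values M s′ (outputs N K p)
        uniform p (v , refl) (v′ , refl) eq =
          trans (values-outputs (g v) v p) (trans (half-pair (G ∘ halves v) p) (trans
            (cong G (trans (sym (values-inputs (g v) v p)) (trans eq (values-inputs (g v′) v′ p))))
            (sym (trans (values-outputs (g v′) v′ p) (half-pair (G ∘ halves v′) p)))))

        same-G : ∀ {s} → Graph em M g s → ⟦_⟧ M (sameFunction N K) (value M s ∘ locate N K) (λ ())
        same-G (v , refl) eq k = trans (locate-G v (false , inj₂ k)) (trans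
          (cong (λ e → Vec.lookup (G e) k) (lookup-ext λ i →
            trans (sym (locate-G v (false , inj₁ i))) (trans (eq i) (locate-G v (true , inj₁ i)))))
          (sym (locate-G v (true , inj₂ k))))

        meaning-G : ∀ {s} → Graph em M g s →
          ⟦_⟧ M c (value M s ∘ locate N K ∘ loc) (HoldsL (value M s) ∘ lit′)
        meaning-G (v , refl) = from (meaning-cong (locate-G v)) (meaning (halves v))

-- Finite index sets, and truth values as signed equations.

Finite : Set → Set
Finite I = ∃ λ n → I ↔ Fin n

finite-⊥ : Finite ⊥
finite-⊥ = 0 , ↔-sym 0↔⊥

finite-⊤ : Finite ⊤
finite-⊤ = 1 , ↔-sym 1↔⊤

finite-Fin : ∀ {n} → Finite (Fin n)
finite-Fin = _ , ↔-refl

infixr 4 _finite-⊎_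

_finite-⊎_ : ∀ {I J} → Finite I → Finite J → Finite (I ⊎ J)
(_ , f) finite-⊎ (_ , g) = _ , ↔-sym +↔⊎ ↔-∘ (f ⊎-↔ g)

module _ {ℓ} (em : ExcludedMiddle ℓ) {A : Set ℓ} (a₀ : A) where

  -- A truth value is a signed equation.  If there are two different elements
  -- the positive sign will do; otherwise all equations hold, and the sign
  -- carries the truth value.
  module _ {B : Set} {N : ℕ} (T : B → Vec A N → Set ℓ) where

    record Equations : Set ℓ where
      field
        sign      : B → Bool
        lhs rhs   : B → Vec A N → A
        signed⇔   : ∀ b e → Signed (sign b) (lhs b e ≡ rhs b e) ⇔ T b e

    equations : Equations
    equations with em {Σ A λ x → Σ A λ y → x ≢ y}
    ... | yes (x , y , x≢y) = record
      { sign = λ _ → true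
      ; lhs  = λ _ _ → x
      ; rhs  = λ b e → if does (em {T b e}) then x else y
      ; signed⇔ = iff
      }
      where
      iff : ∀ b e → x ≡ (if does (em {T b e}) then x else y) ⇔ T b e
      iff b e with em {T b e}
      ... | yes t = mk⇔ (λ _ → t) (λ _ → refl)
      ... | no ¬t = mk⇔ (λ x≡y → ⊥-elim (x≢y x≡y)) (λ t → ⊥-elim (¬t t))
    -- All points coincide here, so the truth value at an arbitrary one fixes the sign.
    ... | no none = record
      { sign = λ b → does (em {T b (Vec.replicate N a₀)})
      ; lhs  = λ _ _ → a₀
      ; rhs  = λ _ _ → a₀
      ; signed⇔ = iff
      }
      where
      equal : ∀ {n} (v w : Vec A n) → v ≡ w
      equal []      []      = refl
      equal (x ∷ v) (y ∷ w) with em {x ≡ y}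
      ... | yes x≡y = cong₂ _∷_ x≡y (equal v w)
      ... | no x≢y  = ⊥-elim (none (x , y , x≢y))

      iff : ∀ b e → Signed (does (em {T b (Vec.replicate N a₀)})) (a₀ ≡ a₀) ⇔ T b e
      iff b e with em {T b (Vec.replicate N a₀)}
      ... | yes t = mk⇔ (λ _ → subst (T b) (equal _ e) t) (λ _ → refl)
      ... | no ¬t = mk⇔ (λ ≢ → ⊥-elim (≢ refl)) (λ t → ⊥-elim (¬t (subst (T b) (equal e _) t)))

module _ {B J : Set} (finB : Finite B) (finJ : Finite J) (N : ℕ) where

  private
    -- A truth value takes up two outputs, the sides of its equation; a function takes up one.
    finO : Finite ((B ⊎ B) ⊎ J)
    finO = (finB finite-⊎ finB) finite-⊎ finJ

    K = proj₁ finO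
    k = proj₁ finB

    code : (B ⊎ B) ⊎ J → Fin K
    code = Inverse.to (proj₂ finO)

  normal-locate : Bool × (Fin N ⊎ J) → Location N K
  normal-locate (p , x) = p , Sum.map₂ (code ∘ inj₂) x

  normal-literal : (B → Bool) → Bool × B → Literal (Location N K)
  normal-literal β (p , b) =
    β b , (p , inj₂ (code (inj₁ (inj₁ b)))) , (p , inj₂ (code (inj₁ (inj₂ b))))

  -- A sign has to be the same at all points, so it is guessed before any point is quantified.
  normalForm : ∀ {S} → QF S (Bool × (Fin N ⊎ J)) (Bool × B) → Formula S []
  normalForm c = ⋁ᵈ k λ β →
    twoPoint N K normal-locate (normal-literal (Vec.lookup β ∘ Inverse.to (proj₂ finB))) c

  module _ {ℓ S} (em : ExcludedMiddle ℓ) (M : Structure S ℓ) where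

    private A = Carrier M

    coordinate : (J → Vec A N → A) → Vec A N → Fin N ⊎ J → A
    coordinate g e = [ Vec.lookup e , (λ j → g j e) ]′

    module _ (c : QF S (Bool × (Fin N ⊎ J)) (Bool × B)) where

      NormalMeaning : (J → Vec A N → A) → (B → Vec A N → Set ℓ) → (Bool → Vec A N) → Set ℓ
      NormalMeaning g T e =
        ⟦_⟧ M c (λ (p , x) → coordinate g (e p) x) (λ (p , b) → T b (e p))

      win-normalForm : Win M (normalForm c) Abelard ｛ ∅ ｝ ⇔
                       (∃ λ g → ∃ λ T → ∀ e → NormalMeaning g T e)
      win-normalForm = mk⇔ forth back
        where
        forth : Win M (normalForm c) Abelard ｛ ∅ ｝ → ∃ λ g → ∃ λ T → ∀ e → NormalMeaning g T e
        forth w with to (win-⋁ em M k) w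
        ... | β , w′ with to (win-twoPoint em M N K normal-locate
                               (normal-literal (Vec.lookup β ∘ Inverse.to (proj₂ finB))) c) w′
        ... | G , meaning = g , T , λ e → to (⟦⟧-cong M c (same e) λ _ → mk⇔ id id) (meaning e)
          where
          g : J → Vec A N → A
          g j e = Vec.lookup (G e) (code (inj₂ j))
          T : B → Vec A N → Set ℓ
          T b e = Signed (Vec.lookup β (Inverse.to (proj₂ finB) b))
            (Vec.lookup (G e) (code (inj₁ (inj₁ b))) ≡ Vec.lookup (G e) (code (inj₁ (inj₂ b))))
          same : ∀ e → environment N K e (G ∘ e) ∘ normal-locate ≗ λ (p , x) → coordinate g (e p) x
          same e (p , inj₁ i) = refl
          same e (p , inj₂ j) = refl

        back : (∃ λ g → ∃ λ T → ∀ e → NormalMeaning g T e) → Win M (normalForm c) Abelard ｛ ∅ ｝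
        back (g , T , meaning) = from (win-⋁ em M k) (β , from (win-twoPoint em M N K normal-locate
            (normal-literal (Vec.lookup β ∘ Inverse.to (proj₂ finB))) c)
            (G , λ e → from (⟦⟧-cong M c (same e) (holds e)) (meaning e)))
          where
          open Equations (equations em (point M) T)

          β : Vec Bool k
          β = Vec.tabulate (sign ∘ Inverse.from (proj₂ finB))

          output : (B ⊎ B) ⊎ J → Vec A N → A
          output = [ [ lhs , rhs ]′ , g ]′

          G : Vec A N → Vec A K
          G e = Vec.tabulate (λ i → output (Inverse.from (proj₂ finO) i) e)

          lookup-G : ∀ e o → Vec.lookup (G e) (code o) ≡ output o e
          lookup-G e o = trans (lookup∘tabulate _ (code o))
            (cong (λ o′ → output o′ e) (Inverse.strictlyInverseʳ (proj₂ finO) o))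

          β-sign : ∀ b → Vec.lookup β (Inverse.to (proj₂ finB) b) ≡ sign b
          β-sign b = trans (lookup∘tabulate _ (Inverse.to (proj₂ finB) b))
                           (cong sign (Inverse.strictlyInverseʳ (proj₂ finB) b))

          same : ∀ e → environment N K e (G ∘ e) ∘ normal-locate ≗ λ (p , x) → coordinate g (e p) x
          same e (p , inj₁ i) = refl
          same e (p , inj₂ j) = lookup-G (e p) (inj₂ j)

          holds : ∀ e ((p , b) : Bool × B) →
            HoldsL (environment N K e (G ∘ e))
                   (normal-literal (Vec.lookup β ∘ Inverse.to (proj₂ finB)) (p , b)) ⇔ T b (e p)
          holds e (p , b)
            rewrite β-sign b
                  | lookup-G (e p) (inj₁ (inj₁ b))
                  | lookup-G (e p) (inj₁ (inj₂ b)) = signed⇔ b (e p)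

-- Labels of the terms and subformulas of a matrix.

module _ {S : Signature} where

  mutual
    TermLabel : ∀ {V} → Term S V → Set
    TermLabel (var x x∈) = ⊥
    TermLabel (app f ts) = ⊤ ⊎ TermsLabel ts

    TermsLabel : ∀ {V n} → Vec (Term S V) n → Set
    TermsLabel []       = ⊥
    TermsLabel (t ∷ ts) = TermLabel t ⊎ TermsLabel ts

  -- The functions to be quantified: the value of each compound term and a
  -- Skolem function for each existential quantifier.
  FunLabel : ∀ {V} → FO S V → Set
  FunLabel (rel R ts) = TermsLabel ts
  FunLabel (t ≐ u)    = TermLabel t ⊎ TermLabel u
  FunLabel (neg ψ)    = FunLabel ψ
  FunLabel (ψ ∨ θ)    = FunLabel ψ ⊎ FunLabel θ
  FunLabel (ex v ψ)   = ⊤ ⊎ FunLabel ψ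

  mutual
    -- The relations to be quantified: the truth of each subformula.
    RelLabel : ∀ {V} → FO S V → Set
    RelLabel ψ = ⊤ ⊎ ProperRelLabel ψ

    ProperRelLabel : ∀ {V} → FO S V → Set
    ProperRelLabel (rel R ts) = ⊥
    ProperRelLabel (t ≐ u)    = ⊥
    ProperRelLabel (neg ψ)    = RelLabel ψ
    ProperRelLabel (ψ ∨ θ)    = RelLabel ψ ⊎ RelLabel θ
    ProperRelLabel (ex v ψ)   = RelLabel ψ

  mutual
    finite-TermLabel : ∀ {V} (t : Term S V) → Finite (TermLabel t)
    finite-TermLabel (var x x∈) = finite-⊥
    finite-TermLabel (app f ts) = finite-⊤ finite-⊎ finite-TermsLabel ts

    finite-TermsLabel : ∀ {V n} (ts : Vec (Term S V) n) → Finite (TermsLabel ts)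
    finite-TermsLabel []       = finite-⊥
    finite-TermsLabel (t ∷ ts) = finite-TermLabel t finite-⊎ finite-TermsLabel ts

  finite-FunLabel : ∀ {V} (ψ : FO S V) → Finite (FunLabel ψ)
  finite-FunLabel (rel R ts) = finite-TermsLabel ts
  finite-FunLabel (t ≐ u)    = finite-TermLabel t finite-⊎ finite-TermLabel u
  finite-FunLabel (neg ψ)    = finite-FunLabel ψ
  finite-FunLabel (ψ ∨ θ)    = finite-FunLabel ψ finite-⊎ finite-FunLabel θ
  finite-FunLabel (ex v ψ)   = finite-⊤ finite-⊎ finite-FunLabel ψ

  finite-RelLabel : ∀ {V} (ψ : FO S V) → Finite (RelLabel ψ)
  finite-RelLabel (rel R ts) = finite-⊤ finite-⊎ finite-⊥
  finite-RelLabel (t ≐ u)    = finite-⊤ finite-⊎ finite-⊥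
  finite-RelLabel (neg ψ)    = finite-⊤ finite-⊎ finite-RelLabel ψ
  finite-RelLabel (ψ ∨ θ)    = finite-⊤ finite-⊎ finite-RelLabel ψ finite-⊎ finite-RelLabel θ
  finite-RelLabel (ex v ψ)   = finite-⊤ finite-⊎ finite-RelLabel ψ

  mutual
    termBound : ∀ {V} → Term S V → ℕ
    termBound (var x x∈) = 0
    termBound (app f ts) = funArity S f ⊔ termsBound ts

    termsBound : ∀ {V n} → Vec (Term S V) n → ℕ
    termsBound []       = 0
    termsBound (t ∷ ts) = termBound t ⊔ termsBound ts

  -- One number bounds quantified variables and arities alike, since a point serves both as an
  -- assignment and as an argument list. In a closed formula every variable is counted at its
  -- quantifier.
  bound : ∀ {V} → FO S V → ℕ
  bound (rel R ts) = relArity S R ⊔ termsBound ts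
  bound (t ≐ u)    = termBound t ⊔ termBound u
  bound (neg ψ)    = bound ψ
  bound (ψ ∨ θ)    = bound ψ ⊔ bound θ
  bound (ex v ψ)   = v ⊔ bound ψ

-- Local laws of a refutation, at two points.

-- Total, because the irrelevant membership proof of a variable yields no bound to compute with.
-- Coordinates run from 0 to n, hence `suc n`.
clamp : ∀ n → ℕ → Fin (suc n)
clamp zero    _       = zero
clamp (suc n) zero    = zero
clamp (suc n) (suc x) = suc (clamp n x)

toℕ-clamp : ∀ {n x} → x ≤ n → toℕ (clamp n x) ≡ x
toℕ-clamp {zero}  z≤n       = refl
toℕ-clamp {suc n} z≤n       = refl
toℕ-clamp {suc n} (s≤s x≤n) = cong suc (toℕ-clamp x≤n)

clamp-injective : ∀ {n x y} → x ≤ n → y ≤ n → clamp n x ≡ clamp n y → x ≡ y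
clamp-injective x≤n y≤n eq = trans (sym (toℕ-clamp x≤n)) (trans (cong toℕ eq) (toℕ-clamp y≤n))

-- A point e of A^(n+1) represents the assignment of its coordinate x to the
-- variable x.  Each clause below relates the labels of a node and of its
-- children at one point, or at two points where the second one is obtained by
-- updating a variable or lists the arguments of a second-order variable.
module Encoding {S : Signature} (fs rs : List ℕ) (n : ℕ) {J B : Set}
  (funVar : Fin (length fs) → J) (relVar : Fin (length rs) → B) where

  private
    S′ = extend S fs rs
    N  = suc n

  Coordinate : Set
  Coordinate = Fin N ⊎ J

  Clause : Set
  Clause = QF S (Bool × Coordinate) (Bool × B)

  termRef : ∀ {V} (t : Term S′ V) → (TermLabel t → J) → Coordinate
  termRef (var x x∈) j = inj₁ (clamp n x)
  termRef (app f ts) j = inj₂ (j (inj₁ tt))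

  termRefs : ∀ {V k} (ts : Vec (Term S′ V) k) → (TermsLabel ts → J) → Vec Coordinate k
  termRefs []       j = []
  termRefs (t ∷ ts) j = termRef t (j ∘ inj₁) ∷ termRefs ts (j ∘ inj₂)

  here∙ there∙ : Coordinate → Bool × Coordinate
  here∙  x = false , x
  there∙ x = true , x

  -- The coordinates from k on are left free. To extract a function from its label they are padded
  -- with `point M`; in the other direction the label ignores them.
  atArguments : ∀ {k} → Vec Coordinate k → Clause
  atArguments xs = allQ λ i → eqQ (there∙ (inj₁ (clamp n (toℕ i)))) (here∙ (Vec.lookup xs i))

  updated : Fin N → Bool × Coordinate → Fin N → Bool × Coordinate
  updated v x i = if does (i ≟ᶠ v) then x else here∙ (inj₁ i)

  atUpdate : Fin N → Bool × Coordinate → Clause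
  atUpdate v x = allQ λ i → eqQ (there∙ (inj₁ i)) (updated v x i)

  infix 5 _⇔Q_
  _⇔Q_ : Clause → Clause → Clause
  c ⇔Q d = andQ (impQ c d) (impQ d c)

  mutual
    termClauses : ∀ {V} (t : Term S′ V) → (TermLabel t → J) → Clause
    termClauses (var x x∈) j = allQ {n = 0} λ ()
    termClauses (app (inj₁ f) ts) j =
      andQ (funQ f (Vec.map here∙ (termRefs ts (j ∘ inj₂))) (here∙ (inj₂ (j (inj₁ tt)))))
           (termsClauses ts (j ∘ inj₂))
    termClauses (app (inj₂ i) ts) j =
      andQ (impQ (atArguments (termRefs ts (j ∘ inj₂)))
                 (eqQ (here∙ (inj₂ (j (inj₁ tt)))) (there∙ (inj₂ (funVar i)))))
           (termsClauses ts (j ∘ inj₂))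

    termsClauses : ∀ {V k} (ts : Vec (Term S′ V) k) → (TermsLabel ts → J) → Clause
    termsClauses []       j = allQ {n = 0} λ ()
    termsClauses (t ∷ ts) j = andQ (termClauses t (j ∘ inj₁)) (termsClauses ts (j ∘ inj₂))

  truth : ∀ {V} (ψ : FO S′ V) → (RelLabel ψ → B) → Bool → Clause
  truth ψ b p = boolQ (p , b (inj₁ tt))

  clauses : ∀ {V} (ψ : FO S′ V) → (FunLabel ψ → J) → (RelLabel ψ → B) → Clause
  clauses (rel (inj₁ R) ts) j b =
    andQ (boolQ (false , b (inj₁ tt)) ⇔Q relQ R (Vec.map here∙ (termRefs ts j))) (termsClauses ts j)
  clauses (rel (inj₂ i) ts) j b =
    andQ (impQ (atArguments (termRefs ts j))
               (boolQ (false , b (inj₁ tt)) ⇔Q boolQ (true , relVar i)))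
         (termsClauses ts j)
  clauses (t ≐ u) j b =
    andQ (boolQ (false , b (inj₁ tt)) ⇔Q
          eqQ (here∙ (termRef t (j ∘ inj₁))) (here∙ (termRef u (j ∘ inj₂))))
         (andQ (termClauses t (j ∘ inj₁)) (termClauses u (j ∘ inj₂)))
  clauses (neg ψ) j b =
    andQ (boolQ (false , b (inj₁ tt)) ⇔Q notQ (truth ψ (b ∘ inj₂) false))
         (clauses ψ j (b ∘ inj₂))
  clauses (ψ ∨ θ) j b =
    andQ (boolQ (false , b (inj₁ tt)) ⇔Q
          impQ (notQ (truth ψ (b ∘ inj₂ ∘ inj₁) false)) (truth θ (b ∘ inj₂ ∘ inj₂) false))
         (andQ (clauses ψ (j ∘ inj₁) (b ∘ inj₂ ∘ inj₁))
               (clauses θ (j ∘ inj₂) (b ∘ inj₂ ∘ inj₂)))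
  -- In the first law the second point may differ from the first at v only, and its own coordinate
  -- there is an arbitrary witness; in the second law it must be the Skolem value.
  clauses (ex v ψ) j b =
    andQ (impQ (atUpdate (clamp n v) (there∙ (inj₁ (clamp n v))))
               (impQ (truth ψ (b ∘ inj₂) true) (boolQ (false , b (inj₁ tt)))))
   (andQ (impQ (atUpdate (clamp n v) (here∙ (inj₂ (j (inj₁ tt)))))
               (impQ (boolQ (false , b (inj₁ tt))) (truth ψ (b ∘ inj₂) true)))
         (clauses ψ (j ∘ inj₂) (b ∘ inj₂)))

  refutation : ∀ {V} (ψ : FO S′ V) → (FunLabel ψ → J) → (RelLabel ψ → B) → Clause
  refutation ψ j b = andQ (notQ (truth ψ b false)) (clauses ψ j b)

  module _ {ℓ} (em : ExcludedMiddle ℓ) (M : Structure S ℓ) where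

    private
      A = Carrier M

    scope : ∀ V → Vec A N → Assignment A V
    scope V e x _ = Vec.lookup e (clamp n x)

    Low : Dom → Set
    Low V = ∀ {x} → x ∈ V → x ≤ n

    low-∷ : ∀ {v V} → v ≤ n → Low V → Low (v ∷ V)
    low-∷ v≤n low (here refl) = v≤n
    low-∷ v≤n low (there x∈)  = low x∈

    nthOrPoint : ∀ {k} → Vec A k → ℕ → A
    nthOrPoint []      _       = point M
    nthOrPoint (a ∷ v) zero    = a
    nthOrPoint (a ∷ v) (suc x) = nthOrPoint v x

    nthOrPoint-toℕ : ∀ {k} (v : Vec A k) i → nthOrPoint v (toℕ i) ≡ Vec.lookup v i
    nthOrPoint-toℕ (a ∷ v) zero    = refl
    nthOrPoint-toℕ (a ∷ v) (suc i) = nthOrPoint-toℕ v i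

    pad : ∀ {k} → Vec A k → Vec A N
    pad v = Vec.tabulate (nthOrPoint v ∘ toℕ)

    arguments : ∀ {k} → Vec A N → Vec A k
    arguments e = Vec.tabulate (λ i → Vec.lookup e (clamp n (toℕ i)))

    lookup-pad : ∀ {k} → k ≤ n → (v : Vec A k) → ∀ i →
                 Vec.lookup (pad v) (clamp n (toℕ i)) ≡ Vec.lookup v i
    lookup-pad k≤n v i = trans (lookup∘tabulate (nthOrPoint v ∘ toℕ) (clamp n (toℕ i)))
      (trans (cong (nthOrPoint v) (toℕ-clamp (<⇒≤ (≤-trans (toℕ<n i) k≤n)))) (nthOrPoint-toℕ v i))

    -- Hilbert's choice operator, obtained from the witness inside a positive decision; it provides
    -- the Skolem functions.
    choose : (A → Set ℓ) → A
    choose Q with em {∃ Q}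
    ... | yes (m , _) = m
    ... | no _        = point M

    choose-holds : ∀ (Q : A → Set ℓ) → ∃ Q → Q (choose Q)
    choose-holds Q q with em {∃ Q}
    ... | yes (_ , h) = h
    ... | no none     = ⊥-elim (none q)

    module Samples (g : J → Vec A N → A) (T : B → Vec A N → Set ℓ) where

      at : Vec A N → Coordinate → A
      at e = [ Vec.lookup e , (λ j → g j e) ]′

      Holds : Clause → (Bool → Vec A N) → Set ℓ
      Holds c e = ⟦_⟧ M c (λ (p , x) → at (e p) x) (λ (p , b) → T b (e p))

      Updated : (Bool → Vec A N) → Fin N → Bool × Coordinate → Set ℓ
      Updated e v x = Holds (atUpdate v x) e

      scope-update : ∀ {V v} → Low V → v ≤ n → ∀ e ((p , x) : Bool × Coordinate) →
        Updated e (clamp n v) (p , x) →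
        scope (v ∷ V) (e true) ≈ (scope V (e false) [ at (e p) x / v ])
      scope-update {v = v} low v≤n e x eq y y∈ with y ≟ v | eq (clamp n y)
      scope-update low v≤n e x eq y y∈ | yes refl | eq-y with clamp n y ≟ᶠ clamp n y
      ... | yes _ = eq-y
      ... | no ≢  = ⊥-elim (≢ refl)
      scope-update {v = v} low v≤n e x eq y y∈ | no y≢v | eq-y with clamp n y ≟ᶠ clamp n v
      -- Distinct variables would share a coordinate only above n, which `low` and `v≤n` exclude.
      ... | yes y≡v = ⊥-elim-irr (y≢v (clamp-injective (low (other y≢v y∈)) v≤n y≡v))
      ... | no _    = eq-y

      points : Vec A N → Vec A N → Bool → Vec A N
      points e e′ p = if p then e′ else e

      updated-holds : ∀ e v m ((p , x) : Bool × Coordinate) →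
        at (points e (e Vec.[ v ]≔ m) p) x ≡ m →
        Updated (points e (e Vec.[ v ]≔ m)) v (p , x)
      updated-holds e v m x x≡m i with i ≟ᶠ v
      ... | yes refl = trans (lookup∘update i e m) (sym x≡m)
      ... | no i≢v   = lookup∘update′ i≢v e m

      at-here∙ : ∀ (e : Bool → Vec A N) {k} (xs : Vec Coordinate k) →
        Vec.map (λ (p , x) → at (e p) x) (Vec.map here∙ xs) ≡ Vec.map (at (e false)) xs
      at-here∙ e xs = sym (map-∘ _ here∙ xs)

    module _ (g : J → Vec A N → A) (T : B → Vec A N → Set ℓ) where

      sampledFun : (i : Fin (length fs)) → Vec A (lookup fs i) → A
      sampledFun i v = g (funVar i) (pad v)

      sampledRel : (i : Fin (length rs)) → Vec A (lookup rs i) → Set ℓ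
      sampledRel i v = T (relVar i) (pad v)

      private
        F  = sampledFun
        P  = sampledRel
        M′ = expand fs rs M F P

      open Samples g T

      mutual
        -- Laws about one point are used with both points equal to e. An applied second-order
        -- variable takes the padded list of argument values as second point, which is where
        -- `sampledFun` reads its value.
        term-sound : ∀ {V} (t : Term S′ V) j → termBound t ≤ n →
          (∀ e → Holds (termClauses t j) e) →
          ∀ e → value M′ (scope V e) t ≡ at e (termRef t j)
        term-sound (var x x∈) j le h e = refl
        term-sound (app (inj₁ f) ts) j le h e =
          trans (cong (funᴹ M f) (trans
                  (terms-sound ts _ (m⊔n≤o⇒n≤o _ _ le) (proj₂ ∘ h) e)
                  (sym (at-here∙ (λ _ → e) (termRefs ts (j ∘ inj₂))))))
                (proj₁ (h (λ _ → e)))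
        term-sound (app (inj₂ i) ts) j le h e =
          trans (cong (F i) (terms-sound ts _ (m⊔n≤o⇒n≤o _ _ le) (proj₂ ∘ h) e))
            (sym (proj₁ (h (points e (pad v))) λ k →
              trans (lookup-pad (m⊔n≤o⇒m≤o _ _ le) v k) (lookup-map k (at e) xs)))
          where
          xs = termRefs ts (j ∘ inj₂)
          v  = Vec.map (at e) xs

        terms-sound : ∀ {V k} (ts : Vec (Term S′ V) k) j → termsBound ts ≤ n →
          (∀ e → Holds (termsClauses ts j) e) →
          ∀ e → values M′ (scope V e) ts ≡ Vec.map (at e) (termRefs ts j)
        terms-sound []       j le h e = refl
        terms-sound (t ∷ ts) j le h e = cong₂ _∷_
          (term-sound t _ (m⊔n≤o⇒m≤o _ _ le) (proj₁ ∘ h) e)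
          (terms-sound ts _ (m⊔n≤o⇒n≤o (termBound t) _ le) (proj₂ ∘ h) e)

      -- The truth labels obey Tarski's clauses, so induction identifies them with truth. The laws
      -- are assumed at all points because a quantifier leads from e to its updates.
      clauses-sound : ∀ {V} (ψ : FO S′ V) j b → bound ψ ≤ n → Low V →
        (∀ e → Holds (clauses ψ j b) e) →
        ∀ e → M′ , scope V e ⊨ ψ ⇔ T (b (inj₁ tt)) e
      clauses-sound {V} (rel (inj₁ R) ts) j b le low h e = mk⇔
        (λ r → proj₂ (proj₁ (h (λ _ → e))) (subst (relᴹ M R) eq r))
        (λ t → subst (relᴹ M R) (sym eq) (proj₁ (proj₁ (h (λ _ → e))) t))
        where
        eq : values M′ (scope V e) ts ≡ _
        eq = trans (terms-sound ts j (m⊔n≤o⇒n≤o _ _ le) (proj₂ ∘ h) e)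
                   (sym (at-here∙ (λ _ → e) (termRefs ts j)))
      clauses-sound {V} (rel (inj₂ i) ts) j b le low h e = mk⇔
        (λ r → proj₂ iff (subst (P i) eq r))
        (λ t → subst (P i) (sym eq) (proj₁ iff t))
        where
        v = Vec.map (at e) (termRefs ts j)
        eq : values M′ (scope V e) ts ≡ v
        eq = terms-sound ts j (m⊔n≤o⇒n≤o _ _ le) (proj₂ ∘ h) e
        iff = proj₁ (h (points e (pad v))) λ k →
          trans (lookup-pad (m⊔n≤o⇒m≤o _ _ le) v k) (lookup-map k (at e) (termRefs ts j))
      clauses-sound (t ≐ u) j b le low h e = mk⇔
        (λ eq → proj₂ (proj₁ (h (λ _ → e))) (trans (sym t≡) (trans eq u≡)))
        (λ l → trans t≡ (trans (proj₁ (proj₁ (h (λ _ → e))) l) (sym u≡)))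
        where
        t≡ = term-sound t _ (m⊔n≤o⇒m≤o _ _ le) (proj₁ ∘ proj₂ ∘ h) e
        u≡ = term-sound u _ (m⊔n≤o⇒n≤o (termBound t) _ le) (proj₂ ∘ proj₂ ∘ h) e
      clauses-sound (neg ψ) j b le low h e = mk⇔
        (λ ¬r → proj₂ (proj₁ (h (λ _ → e))) (¬r ∘ from ih))
        (λ t r → proj₁ (proj₁ (h (λ _ → e))) t (to ih r))
        where ih = clauses-sound ψ j (b ∘ inj₂) le low (proj₂ ∘ h) e
      clauses-sound (ψ ∨ θ) j b le low h e = mk⇔
        (λ r → proj₂ (proj₁ (h (λ _ → e)))
          λ ¬l → [ (λ l → ⊥-elim (¬l (to ihψ l))) , to ihθ ]′ r)
        (λ t → split (proj₁ (proj₁ (h (λ _ → e))) t))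
        where
        ihψ = clauses-sound ψ (j ∘ inj₁) (b ∘ inj₂ ∘ inj₁) (m⊔n≤o⇒m≤o _ _ le) low
                (proj₁ ∘ proj₂ ∘ h) e
        ihθ = clauses-sound θ (j ∘ inj₂) (b ∘ inj₂ ∘ inj₂) (m⊔n≤o⇒n≤o (bound ψ) _ le) low
                (proj₂ ∘ proj₂ ∘ h) e
        Tψ = T (b (inj₂ (inj₁ (inj₁ tt)))) e
        split : (¬ Tψ → T (b (inj₂ (inj₂ (inj₁ tt)))) e) → _
        split k with em {Tψ}
        ... | yes t = inj₁ (from ihψ t)
        ... | no ¬t = inj₂ (from ihθ (k ¬t))
      clauses-sound {V} (ex v ψ) j b le low h e = mk⇔
        (λ (m , r) →
          let e′ = e Vec.[ clamp n v ]≔ m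
              x  = true , inj₁ (clamp n v)
              m≡ = lookup∘update (clamp n v) e m
              up = updated-holds e (clamp n v) m x m≡ in
          proj₁ (h (points e e′)) up (to (ih e′)
            (⊨-cong M′ ψ
              (λ y y∈ → sym (scope-update low v≤n (points e e′) x up y y∈))
              (subst (λ a → M′ , scope V e [ a / v ] ⊨ ψ) (sym m≡) r))))
        (λ t →
          let m  = g (j (inj₁ tt)) e
              e′ = e Vec.[ clamp n v ]≔ m
              x  = false , inj₂ (j (inj₁ tt))
              up = updated-holds e (clamp n v) m x refl in
          m , ⊨-cong M′ ψ (scope-update low v≤n (points e e′) x up)
                (from (ih e′) (proj₁ (proj₂ (h (points e e′))) up t)))
        where
        v≤n = m⊔n≤o⇒m≤o v _ le
        ih = clauses-sound ψ (j ∘ inj₂) (b ∘ inj₂) (m⊔n≤o⇒n≤o v _ le) (low-∷ v≤n low)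
               (proj₂ ∘ proj₂ ∘ h)

      refutation-sound : ∀ (ψ : FO S′ []) j b → bound ψ ≤ n →
        (∀ e → Holds (refutation ψ j b) e) → ¬ (M′ , ∅ ⊨ ψ)
      refutation-sound ψ j b le h sat = proj₁ (h (λ _ → e))
        (to (clauses-sound ψ j b le (λ ()) (proj₂ ∘ h) e) (⊨-cong M′ ψ (λ _ ()) sat))
        where e = Vec.replicate N (point M)

    module _ (F : (i : Fin (length fs)) → Vec A (lookup fs i) → A)
             (P : (i : Fin (length rs)) → Vec A (lookup rs i) → Set ℓ) where

      private
        M′ = expand fs rs M F P

      mutual
        termFun : ∀ {V} (t : Term S′ V) → TermLabel t → Vec A N → A
        termFun {V} (app f ts) (inj₁ tt) e = value M′ (scope V e) (app f ts)
        termFun (app f ts) (inj₂ x) e      = termsFun ts x e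

        termsFun : ∀ {V k} (ts : Vec (Term S′ V) k) → TermsLabel ts → Vec A N → A
        termsFun (t ∷ ts) = [ termFun t , termsFun ts ]′

      formulaFun : ∀ {V} (ψ : FO S′ V) → FunLabel ψ → Vec A N → A
      formulaFun (rel R ts) = termsFun ts
      formulaFun (t ≐ u)    = [ termFun t , termFun u ]′
      formulaFun (neg ψ)    = formulaFun ψ
      formulaFun (ψ ∨ θ)    = [ formulaFun ψ , formulaFun θ ]′
      formulaFun {V} (ex v ψ) (inj₁ tt) e = choose (λ m → M′ , scope V e [ m / v ] ⊨ ψ)
      formulaFun (ex v ψ) (inj₂ x) e      = formulaFun ψ x e

      mutual
        formulaRel : ∀ {V} (ψ : FO S′ V) → RelLabel ψ → Vec A N → Set ℓ
        formulaRel {V} ψ (inj₁ tt) e = M′ , scope V e ⊨ ψ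
        formulaRel ψ (inj₂ x) e      = properRel ψ x e

        properRel : ∀ {V} (ψ : FO S′ V) → ProperRelLabel ψ → Vec A N → Set ℓ
        properRel (neg ψ)  = formulaRel ψ
        properRel (ψ ∨ θ)  = [ formulaRel ψ , formulaRel θ ]′
        properRel (ex v ψ) = formulaRel ψ

      module _ (g : J → Vec A N → A) (T : B → Vec A N → Set ℓ)
        (F-arguments : ∀ i e → g (funVar i) e ≡ F i (arguments e))
        (P-arguments : ∀ i e → T (relVar i) e ≡ P i (arguments e)) where

        open Samples g T

        arguments-map : ∀ (e : Bool → Vec A N) {k} (xs : Vec Coordinate k) →
          Holds (atArguments xs) e → arguments (e true) ≡ Vec.map (at (e false)) xs
        arguments-map e xs h = trans
          (tabulate-cong λ i → trans (h i) (sym (lookup-map i (at (e false)) xs)))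
          (tabulate∘lookup _)

        term-value : ∀ {V} (t : Term S′ V) j → (∀ x e → g (j x) e ≡ termFun t x e) →
          ∀ e → value M′ (scope V e) t ≡ at e (termRef t j)
        term-value (var x x∈) j g≡ e = refl
        term-value (app f ts) j g≡ e = sym (g≡ (inj₁ tt) e)

        terms-value : ∀ {V k} (ts : Vec (Term S′ V) k) j → (∀ x e → g (j x) e ≡ termsFun ts x e) →
          ∀ e → values M′ (scope V e) ts ≡ Vec.map (at e) (termRefs ts j)
        terms-value []       j g≡ e = refl
        terms-value (t ∷ ts) j g≡ e =
          cong₂ _∷_ (term-value t _ (g≡ ∘ inj₁) e) (terms-value ts _ (g≡ ∘ inj₂) e)

        mutual
          term-complete : ∀ {V} (t : Term S′ V) j → (∀ x e → g (j x) e ≡ termFun t x e) →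
            ∀ e → Holds (termClauses t j) e
          term-complete (var x x∈) j g≡ e = λ ()
          term-complete (app (inj₁ f) ts) j g≡ e =
            trans (cong (funᴹ M f) (trans (at-here∙ e (termRefs ts (j ∘ inj₂)))
                                          (sym (terms-value ts _ (g≡ ∘ inj₂) (e false)))))
                  (sym (g≡ (inj₁ tt) (e false))) ,
            terms-complete ts (j ∘ inj₂) (g≡ ∘ inj₂) e
          term-complete (app (inj₂ i) ts) j g≡ e =
            (λ h → trans (g≡ (inj₁ tt) (e false)) (sym (trans (F-arguments i (e true))
              (cong (F i) (trans (arguments-map e (termRefs ts (j ∘ inj₂)) h)
                                 (sym (terms-value ts _ (g≡ ∘ inj₂) (e false)))))))) ,
            terms-complete ts (j ∘ inj₂) (g≡ ∘ inj₂) e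

          terms-complete : ∀ {V k} (ts : Vec (Term S′ V) k) j →
            (∀ x e → g (j x) e ≡ termsFun ts x e) → ∀ e → Holds (termsClauses ts j) e
          terms-complete []       j g≡ e = λ ()
          terms-complete (t ∷ ts) j g≡ e =
            term-complete t (j ∘ inj₁) (g≡ ∘ inj₁) e , terms-complete ts (j ∘ inj₂) (g≡ ∘ inj₂) e

        -- Every label has its intended value at every point, so each law is just the semantic
        -- clause of its node, read at whichever two points satisfy the premise.
        clauses-complete : ∀ {V} (ψ : FO S′ V) j b → bound ψ ≤ n → Low V →
          (∀ x e → g (j x) e ≡ formulaFun ψ x e) →
          (∀ x e → T (b x) e ≡ formulaRel ψ x e) →
          ∀ e → Holds (clauses ψ j b) e
        clauses-complete {V} (rel (inj₁ R) ts) j b le low g≡ T≡ e =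
          ( (λ t → subst (relᴹ M R) eq (subst id (T≡ (inj₁ tt) (e false)) t))
          , (λ r → subst id (sym (T≡ (inj₁ tt) (e false))) (subst (relᴹ M R) (sym eq) r))) ,
          terms-complete ts j g≡ e
          where
          eq : values M′ (scope V (e false)) ts ≡ _
          eq = trans (terms-value ts j g≡ (e false)) (sym (at-here∙ e (termRefs ts j)))
        clauses-complete {V} (rel (inj₂ i) ts) j b le low g≡ T≡ e =
          (λ h → subst id (T-eq h) , subst id (sym (T-eq h))) , terms-complete ts j g≡ e
          where
          T-eq : Holds (atArguments (termRefs ts j)) e →
                 T (b (inj₁ tt)) (e false) ≡ T (relVar i) (e true)
          T-eq h = trans (T≡ (inj₁ tt) (e false)) (sym (trans (P-arguments i (e true))
            (cong (P i) (trans (arguments-map e (termRefs ts j) h)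
                               (sym (terms-value ts j g≡ (e false)))))))
        clauses-complete (t ≐ u) j b le low g≡ T≡ e =
          ( (λ l → trans (sym t≡) (trans (subst id (T≡ (inj₁ tt) (e false)) l) u≡))
          , (λ eq → subst id (sym (T≡ (inj₁ tt) (e false))) (trans t≡ (trans eq (sym u≡))))) ,
          term-complete t _ (g≡ ∘ inj₁) e , term-complete u _ (g≡ ∘ inj₂) e
          where
          t≡ = term-value t (j ∘ inj₁) (g≡ ∘ inj₁) (e false)
          u≡ = term-value u (j ∘ inj₂) (g≡ ∘ inj₂) (e false)
        clauses-complete (neg ψ) j b le low g≡ T≡ e =
          ( (λ t r → subst id own t (subst id child r))
          , (λ ¬r → subst id (sym own) (¬r ∘ subst id (sym child)))) ,
          clauses-complete ψ j (b ∘ inj₂) le low g≡ (T≡ ∘ inj₂) e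
          where
          own = T≡ (inj₁ tt) (e false)
          child = T≡ (inj₂ (inj₁ tt)) (e false)
        clauses-complete {V} (ψ ∨ θ) j b le low g≡ T≡ e =
          ( (λ t ¬l → [ (λ l → ⊥-elim (¬l (subst id (sym childˡ) l))) , subst id (sym childʳ) ]′
                        (subst id own t))
          , (λ k → subst id (sym own) (split k))) ,
          clauses-complete ψ (j ∘ inj₁) (b ∘ inj₂ ∘ inj₁) (m⊔n≤o⇒m≤o _ _ le) low
            (g≡ ∘ inj₁) (T≡ ∘ inj₂ ∘ inj₁) e ,
          clauses-complete θ (j ∘ inj₂) (b ∘ inj₂ ∘ inj₂) (m⊔n≤o⇒n≤o (bound ψ) _ le) low
            (g≡ ∘ inj₂) (T≡ ∘ inj₂ ∘ inj₂) e
          where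
          own = T≡ (inj₁ tt) (e false)
          childˡ = T≡ (inj₂ (inj₁ (inj₁ tt))) (e false)
          childʳ = T≡ (inj₂ (inj₂ (inj₁ tt))) (e false)
          Tψ = T (b (inj₂ (inj₁ (inj₁ tt)))) (e false)
          split : (¬ Tψ → T (b (inj₂ (inj₂ (inj₁ tt)))) (e false)) → M′ , scope V (e false) ⊨ (ψ ∨ θ)
          split k with em {Tψ}
          ... | yes t = inj₁ (subst id childˡ t)
          ... | no ¬t = inj₂ (subst id childʳ (k ¬t))
        clauses-complete {V} (ex v ψ) j b le low g≡ T≡ e =
          (λ up t → subst id (sym own)
            (_ , ⊨-cong M′ ψ (scope-update low v≤n e (true , inj₁ (clamp n v)) up)
                   (subst id child t))) ,
          (λ up t → subst id (sym child)
            (⊨-cong M′ ψ (λ y y∈ → sym (scope-update low v≤n e (false , inj₂ (j (inj₁ tt))) up y y∈))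
              (subst (λ a → M′ , scope V (e false) [ a / v ] ⊨ ψ) (sym (g≡ (inj₁ tt) (e false)))
                (choose-holds _ (subst id own t))))) ,
          clauses-complete ψ (j ∘ inj₂) (b ∘ inj₂) (m⊔n≤o⇒n≤o v _ le) (low-∷ v≤n low)
            (g≡ ∘ inj₂) (T≡ ∘ inj₂) e
          where
          v≤n = m⊔n≤o⇒m≤o v _ le
          own = T≡ (inj₁ tt) (e false)
          child = T≡ (inj₂ (inj₁ tt)) (e true)

        refutation-complete : ∀ (ψ : FO S′ []) j b → bound ψ ≤ n →
          (∀ x e → g (j x) e ≡ formulaFun ψ x e) →
          (∀ x e → T (b x) e ≡ formulaRel ψ x e) →
          ¬ (M′ , ∅ ⊨ ψ) → ∀ e → Holds (refutation ψ j b) e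
        refutation-complete ψ j b le g≡ T≡ ¬sat e =
          (λ t → ¬sat (⊨-cong M′ ψ (λ _ ()) (subst id (T≡ (inj₁ tt) (e false)) t))) ,
          clauses-complete ψ j b le (λ ()) g≡ T≡ e

-- From a universal second-order sentence to a sentence of the game logic.

module _ {S : Signature} (Φ : Π¹₁Sentence S) where

  open Π¹₁Sentence Φ

  private
    n = bound matrix
    B = RelLabel matrix ⊎ Fin (length relVars)
    J = FunLabel matrix ⊎ Fin (length funVars)

    finB : Finite B
    finB = finite-RelLabel matrix finite-⊎ finite-Fin

    finJ : Finite J
    finJ = finite-FunLabel matrix finite-⊎ finite-Fin

    clause : QF S (Bool × (Fin (suc n) ⊎ J)) (Bool × B)
    clause = Encoding.refutation funVars relVars n inj₂ inj₂ matrix inj₁ inj₁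

  -- The negation hands the formula over from Eloise to Abelard, so that the existential moves,
  -- which build the refutation, become his.
  fromΠ¹₁ : Sentence S
  fromΠ¹₁ = neg (normalForm finB finJ (suc n) clause)

  fromΠ¹₁-correct : ∀ {ℓ} → ExcludedMiddle ℓ → (M : Structure S ℓ) →
                    (M ⊨Π¹₁ Φ) ⇔ (M ⊨ₚ⁺ fromΠ¹₁)
  fromΠ¹₁-correct {ℓ} em M = mk⇔ forth back
    where
    open Encoding {S} funVars relVars n {J} {B} inj₂ inj₂
      using (refutation-sound; refutation-complete; formulaFun; formulaRel; arguments;
             sampledFun; sampledRel)

    A = Carrier M

    forth : M ⊨Π¹₁ Φ → M ⊨ₚ⁺ fromΠ¹₁
    forth valid strategy = refute
      (to (win-normalForm finB finJ (suc n) em M clause) (strategy⇒win M ｛ ∅ ｝ fromΠ¹₁ strategy))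
      where
      refute : ¬ (∃ λ g → ∃ λ T → ∀ e → NormalMeaning finB finJ (suc n) em M clause g T e)
      refute (g , T , holds) = refutation-sound em M g T matrix inj₁ inj₁ ≤-refl holds
        (valid (sampledFun em M g T) (sampledRel em M g T))

    back : M ⊨ₚ⁺ fromΠ¹₁ → M ⊨Π¹₁ Φ
    -- Double negation is removed for fixed F and P: the matrix lives at level ℓ, the quantified
    -- statement one level higher.
    back none F P = stable em M λ ¬valid →
      none (win⇒strategy M _ fromΠ¹₁ em
        (from (win-normalForm finB finJ (suc n) em M clause)
          (g , T , refutation-complete em M F P g T (λ _ _ → refl) (λ _ _ → refl)
                     matrix inj₁ inj₁ ≤-refl (λ _ _ → refl) (λ _ _ → refl) ¬valid)))
      where
      g : J → Vec A (suc n) → A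
      g = [ formulaFun em M F P matrix , (λ i e → F i (arguments em M e)) ]′

      T : B → Vec A (suc n) → Set ℓ
      T = [ formulaRel em M F P matrix , (λ i e → P i (arguments em M e)) ]′

theorem3p7 : ∀ {ℓ : Level} → ExcludedMiddle ℓ → (S : Signature) →
    ((φ : Sentence S) → ∃ λ (Φ : Π¹₁Sentence S) → (M : Structure S ℓ) → (M ⊨ₚ⁺ φ) ⇔ (M ⊨Π¹₁ Φ)) ×
    ((Φ : Π¹₁Sentence S) → ∃ λ (φ : Sentence S) → (M : Structure S ℓ) → (M ⊨Π¹₁ Φ) ⇔ (M ⊨ₚ⁺ φ))
theorem3p7 em S =
  (λ φ → toΠ¹₁ φ , λ M → toΠ¹₁-correct em M φ) ,
  (λ Φ → fromΠ¹₁ Φ , λ M → fromΠ¹₁-correct Φ em M)
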